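{- Let $d\ge 2$ and $n\ge 2$ be integers, let $k\ge0$ be such that $n_k\le n<n_{k+1}$, let $\lambda(n)=(l_{k+1},l_k,\ldots,l_0)$, and set $\lambda_i(n)=l_0+l_1d+\cdots+l_{i-1}d^{i-1}$ (so $\lambda_0(n)=0$). Then $$W(D_{n,d};q)=\sum_{i=0}^k d^i(n-n_i+1)q^{2i+1}+\sum_{i=0}^{k'}\left(d^{2i}\left\lfloor\frac{n-m_i}{d^{i+1}}\right\rfloor\binom{d+1}{2}+d^{2i}\binom{l_i+1}{2}+d^i(l_i+1)(\lambda_i(n)+1)\right)q^{2i+2},$$ where $k'=k-1$ if $n_k\le n<m_k$ and $k'=k$ if $m_k\le n<n_{k+1}$.
   Context: For a connected graph $G$, $W(G;q)=\sum_{\{u,v\}}q^{d(u,v)}$ over unordered pairs of distinct vertices, $d$ the graph distance. The $d$-ary dendrimer $D_{n,d}$ is the tree on vertex set $\{1,\ldots,n\}$ defined inductively: $D_{1,d}$ is the single vertex $1$, and $D_{n,d}$ is obtained from $D_{n-1,d}$ by attaching a new leaf $n$ to the smallest-numbered vertex of $D_{n-1,d}$ having degree $\le d$. Define $n_k=2+(d+1)\frac{d^k-1}{d-1}$ and $m_k=3+2d\frac{d^k-1}{d-1}$ for $k\ge0$. For a vertex $m$ with $n_k\le m<n_{k+1}$, its label is $\lambda(m)=(l_{k+1},l_k,\ldots,l_0)$ where $0\le l_i<d$ and $\sum_{i=0}^{k+1}l_id^i=m-n_k+(d-1)d^k$. -}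

module Defs where

open import Data.Empty using (⊥; ⊥-elim)
open import Data.Fin as Fin using (Fin; zero; suc; fromℕ; inject₁)
open import Data.Fin.Properties as Fin using (any?; inject₁-injective; fromℕ≢inject₁)
open import Data.Fin.Relation.Unary.Top using (view; ‵fromℕ; ‵inject₁)
open import Data.List using (List; []; _∷_; _++_; [_]; length; map; filter; foldr; replicate; upTo; allFin; cartesianProduct)
open import Data.List.Relation.Unary.All as All using (All; []; _∷_)
open import Data.List.Relation.Unary.All.Properties using (all-filter)
open import Data.List.Relation.Unary.AllPairs using ([]; _∷_)
open import Data.List.Relation.Unary.Unique.Propositional using (Unique)
open import Data.List.Relation.Unary.Unique.Propositional.Properties using (allFin⁺; filter⁺)
open import Data.Nat using (ℕ; zero; suc; _+_; _*_; _∸_; _^_; _/_; _≤_; _<_; _≤?_; z≤n; s≤s; NonZero; NonTrivial; nonTrivial⇒nonZero; nonTrivial⇒n>1; >-nonZero)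
open import Data.Nat.Properties using (≤-trans; <⇒≤; m^n≢0; m<n⇒0<n∸m)
open import Data.Nat.Combinatorics using (_C_)
open import Data.Nat.ListAction using (sum)
open import Data.Product using (∃; _×_; _,_; proj₁; proj₂)
open import Level using (0ℓ)
open import Relation.Binary using (Rel; Symmetric; Irreflexive) renaming (Decidable to Decidable₂)
open import Relation.Binary.PropositionalEquality using (_≡_; refl; sym; trans)
open import Relation.Nullary using (¬_; yes; no)
open import Relation.Nullary.Decidable using (map′; _×-dec_)
open import Relation.Unary using (Pred; Decidable)

-- Polynomials in q over ℕ as coefficient lists, constant term first.
-- Trailing zeros are allowed, so equality is _≈_ and not _≡_.

Polynomial : Set
Polynomial = List ℕ

coeff : Polynomial → ℕ → ℕ
coeff []      _       = 0
coeff (a ∷ _) zero    = a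
coeff (_ ∷ p) (suc j) = coeff p j

infix 4 _≈_
_≈_ : Rel Polynomial 0ℓ
p ≈ r = ∀ j → coeff p j ≡ coeff r j

infixl 6 _⊕_
_⊕_ : Polynomial → Polynomial → Polynomial
[]      ⊕ r       = r
(a ∷ p) ⊕ []      = a ∷ p
(a ∷ p) ⊕ (b ∷ r) = (a + b) ∷ (p ⊕ r)

infix 7 _·q^_
_·q^_ : ℕ → ℕ → Polynomial
c ·q^ e = replicate e 0 ++ [ c ]

sumᵖ : List Polynomial → Polynomial
sumᵖ = foldr _⊕_ []

-- The upper bound of both range sums is exclusive.

infix 5 sum-syntax sumᵖ-syntax

sum-syntax : ℕ → (ℕ → ℕ) → ℕ
sum-syntax m f = sum (map f (upTo m))

syntax sum-syntax m (λ i → e) = Σ[ i < m ] e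

sumᵖ-syntax : ℕ → (ℕ → Polynomial) → Polynomial
sumᵖ-syntax m f = sumᵖ (map f (upTo m))

syntax sumᵖ-syntax m (λ i → p) = Σᵖ[ i < m ] p

least : {P : Pred ℕ 0ℓ} → Decidable P → ∀ m → P m →
        ∃ λ i → P i × (∀ j → P j → i ≤ j)
least P? zero p = zero , p , λ _ _ → z≤n
least {P} P? (suc m) p with P? zero
... | yes p₀ = zero , p₀ , λ _ _ → z≤n
... | no ¬p₀ with least (λ j → P? (suc j)) m p
...   | i , pᵢ , min = suc i , pᵢ , min′
  where
  min′ : ∀ j → P j → suc i ≤ j
  min′ zero    p₀ = ⊥-elim (¬p₀ p₀)
  min′ (suc j) pⱼ = s≤s (min j pⱼ)

leastFin : ∀ {n} {P : Pred (Fin n) 0ℓ} → Decidable P → ∀ m → P m →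
           ∃ λ i → P i × (∀ j → P j → i Fin.≤ j)
leastFin P? zero p = zero , p , λ _ _ → z≤n
leastFin {P = P} P? (suc m) p with P? zero
... | yes p₀ = zero , p₀ , λ _ _ → z≤n
... | no ¬p₀ with leastFin (λ j → P? (suc j)) m p
...   | i , pᵢ , min = suc i , pᵢ , min′
  where
  min′ : ∀ j → P j → suc i Fin.≤ j
  min′ zero    p₀ = ⊥-elim (¬p₀ p₀)
  min′ (suc j) pⱼ = s≤s (min j pⱼ)

-- Finite simple graphs. The vertex numbered v in {1, …, n} is the element
-- of Fin n with toℕ equal to v − 1.

record Graph (n : ℕ) : Set₁ where
  field
    Adj        : Rel (Fin n) 0ℓ
    adj?       : Decidable₂ Adj
    adj-sym    : Symmetric Adj
    adj-irrefl : Irreflexive _≡_ Adj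

module _ {n : ℕ} (G : Graph n) where
  open Graph G

  degree : Fin n → ℕ
  degree v = length (filter (adj? v) (allFin n))

  data Walk : Fin n → Fin n → ℕ → Set where
    nil  : ∀ {u} → Walk u u 0
    cons : ∀ {u w v ℓ} → Adj u w → Walk w v ℓ → Walk u v (suc ℓ)

  Connected : Set
  Connected = ∀ u v → ∃ λ ℓ → Walk u v ℓ

  walk? : ∀ u v → Decidable (Walk u v)
  walk? u v zero = map′ (λ { refl → nil }) (λ { nil → refl }) (u Fin.≟ v)
  walk? u v (suc ℓ) =
    map′ (λ { (_ , a , p) → cons a p }) (λ { (cons a p) → _ , a , p })
         (any? (λ w → adj? u w ×-dec walk? w v ℓ))

  distance : Connected → Fin n → Fin n → ℕ
  distance conn u v = proj₁ (least (walk? u v) (proj₁ (conn u v)) (proj₂ (conn u v)))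

  -- Each unordered pair {u , v} is listed once, as (u , v) with u < v.

  W : Connected → Polynomial
  W conn = sumᵖ (map (λ (u , v) → 1 ·q^ distance conn u v)
                     (filter (λ (u , v) → u Fin.<? v)
                             (cartesianProduct (allFin n) (allFin n))))

module _ {n : ℕ} (G : Graph n) (p : Fin n) where
  open Graph G

  data LeafAdj : Rel (Fin (suc n)) 0ℓ where
    old  : ∀ {u v} → Adj u v → LeafAdj (inject₁ u) (inject₁ v)
    up   : LeafAdj (fromℕ n) (inject₁ p)
    down : LeafAdj (inject₁ p) (fromℕ n)

  private
    old⁻ : ∀ {i j u v} → LeafAdj i j → i ≡ inject₁ u → j ≡ inject₁ v → Adj u v
    old⁻ (old a) e f with refl ← inject₁-injective e | refl ← inject₁-injective f = a
    old⁻ up      e f = ⊥-elim (fromℕ≢inject₁ e)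
    old⁻ down    e f = ⊥-elim (fromℕ≢inject₁ f)

    up⁻ : ∀ {i j} → LeafAdj i j → i ≡ fromℕ n → j ≡ inject₁ p
    up⁻ (old a) e = ⊥-elim (fromℕ≢inject₁ (sym e))
    up⁻ up      e = refl
    up⁻ down    e = ⊥-elim (fromℕ≢inject₁ (sym e))

    leafSym : Symmetric LeafAdj
    leafSym (old a) = old (adj-sym a)
    leafSym up      = down
    leafSym down    = up

    leafIrrefl : ∀ {i j} → i ≡ j → ¬ LeafAdj i j
    leafIrrefl e (old a) = adj-irrefl (inject₁-injective e) a
    leafIrrefl e up      = fromℕ≢inject₁ e
    leafIrrefl e down    = fromℕ≢inject₁ (sym e)

    leafAdj? : Decidable₂ LeafAdj
    leafAdj? i j with view i | view j
    ... | ‵fromℕ     | ‵fromℕ     = no (leafIrrefl refl)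
    ... | ‵fromℕ     | ‵inject₁ v = map′ (λ { refl → up }) (λ a → inject₁-injective (up⁻ a refl)) (v Fin.≟ p)
    ... | ‵inject₁ u | ‵fromℕ     = map′ (λ { refl → down }) (λ a → inject₁-injective (up⁻ (leafSym a) refl)) (u Fin.≟ p)
    ... | ‵inject₁ u | ‵inject₁ v = map′ old (λ a → old⁻ a refl refl) (adj? u v)

  attachLeaf : Graph (suc n)
  attachLeaf = record
    { Adj        = LeafAdj
    ; adj?       = leafAdj?
    ; adj-sym    = leafSym
    ; adj-irrefl = leafIrrefl
    }

  private
    liftWalk : ∀ {u v ℓ} → Walk G u v ℓ → Walk attachLeaf (inject₁ u) (inject₁ v) ℓ
    liftWalk nil        = nil
    liftWalk (cons a w) = cons (old a) (liftWalk w)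

    snoc : ∀ {u v w ℓ} → Walk attachLeaf u v ℓ → LeafAdj v w → Walk attachLeaf u w (suc ℓ)
    snoc nil        b = cons b nil
    snoc (cons a w) b = cons a (snoc w b)

    unique-length : ∀ {x : Fin (suc n)} {xs} → Unique xs → All (_≡ x) xs → length xs ≤ 1
    unique-length []                  _             = z≤n
    unique-length (_ ∷ [])            _             = s≤s z≤n
    unique-length ((x≢y ∷ _) ∷ _ ∷ _) (e ∷ e′ ∷ _) = ⊥-elim (x≢y (trans e (sym e′)))

  attachLeaf-connected : Connected G → Connected attachLeaf
  attachLeaf-connected conn i j with view i | view j
  ... | ‵fromℕ     | ‵fromℕ     = _ , nil
  ... | ‵fromℕ     | ‵inject₁ v = _ , cons up (liftWalk (proj₂ (conn p v)))
  ... | ‵inject₁ u | ‵fromℕ     = _ , snoc (liftWalk (proj₂ (conn u p))) down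
  ... | ‵inject₁ u | ‵inject₁ v = _ , liftWalk (proj₂ (conn u v))

  degree-leaf : degree attachLeaf (fromℕ n) ≤ 1
  degree-leaf = unique-length
    (filter⁺ (leafAdj? (fromℕ n)) (allFin⁺ (suc n)))
    (All.map (λ a → up⁻ a refl) (all-filter (leafAdj? (fromℕ n)) (allFin (suc n))))

singleVertex : Graph 1
singleVertex = record
  { Adj        = λ _ _ → ⊥
  ; adj?       = λ _ _ → no λ ()
  ; adj-sym    = λ ()
  ; adj-irrefl = λ _ ()
  }

module _ (d : ℕ) .{{_ : NonTrivial d}} where

  private
    1≤d : 1 ≤ d
    1≤d = <⇒≤ (nonTrivial⇒n>1 d)

    instance
      d≢0 : NonZero d
      d≢0 = nonTrivial⇒nonZero d

      d∸1≢0 : NonZero (d ∸ 1)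
      d∸1≢0 = >-nonZero (m<n⇒0<n∸m (nonTrivial⇒n>1 d))

  -- dendrimer n is D_{n,d}; attachable shows that the vertex receiving the
  -- next leaf always exists.

  dendrimer  : ∀ n .{{_ : NonZero n}} → Graph n
  attachable : ∀ n .{{_ : NonZero n}} → ∃ λ v → degree (dendrimer n) v ≤ d

  dendrimer 1             = singleVertex
  dendrimer (suc (suc n)) =
    attachLeaf (dendrimer (suc n))
      (proj₁ (leastFin (λ v → degree (dendrimer (suc n)) v ≤? d)
                       (proj₁ (attachable (suc n))) (proj₂ (attachable (suc n)))))

  attachable 1             = zero , z≤n
  attachable (suc (suc n)) =
    fromℕ (suc n) , ≤-trans (degree-leaf (dendrimer (suc n)) _) 1≤d

  dendrimer-connected : ∀ n .{{_ : NonZero n}} → Connected (dendrimer n)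
  dendrimer-connected 1             zero zero = 0 , nil
  dendrimer-connected (suc (suc n)) =
    attachLeaf-connected (dendrimer (suc n)) _ (dendrimer-connected (suc n))

  -- The quotients are exact, since d − 1 divides dᵏ − 1.

  nₖ : ℕ → ℕ
  nₖ k = 2 + (d + 1) * ((d ^ k ∸ 1) / (d ∸ 1))

  mₖ : ℕ → ℕ
  mₖ k = 3 + 2 * d * ((d ^ k ∸ 1) / (d ∸ 1))

  -- l i is the digit lᵢ of λ(m) = (l_{k+1}, …, l₀); the values of l beyond
  -- index k + 1 play no role. Only meaningful for nₖ k ≤ m < nₖ (k + 1), so
  -- the subtraction m ∸ nₖ k does not truncate.

  IsLabel : (m k : ℕ) → (ℕ → ℕ) → Set
  IsLabel m k l =
    (∀ i → i ≤ k + 1 → l i < d) ×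
    (Σ[ i < k + 2 ] l i * d ^ i) ≡ (m ∸ nₖ k) + (d ∸ 1) * d ^ k

  λᵢ : (ℕ → ℕ) → ℕ → ℕ
  λᵢ l i = Σ[ j < i ] l j * d ^ j

  -- ⌊ a / dᵉ ⌋

  floor/d^ : ℕ → ℕ → ℕ
  floor/d^ a e = _/_ a (d ^ e) {{m^n≢0 d e}}

  -- No subtraction below truncates in the intended range: n ≥ nₖ i for all
  -- i ≤ k, and n ≥ mₖ i for all i ≤ k′, because mₖ i < nₖ (i + 1).

  oddTerm : ℕ → ℕ → Polynomial
  oddTerm n i = (d ^ i * (n ∸ nₖ i + 1)) ·q^ (2 * i + 1)

  evenTerm : ℕ → (ℕ → ℕ) → ℕ → Polynomial
  evenTerm n l i =
    (d ^ (2 * i) * floor/d^ (n ∸ mₖ i) (i + 1) * ((d + 1) C 2)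
      + d ^ (2 * i) * ((l i + 1) C 2)
      + d ^ i * (l i + 1) * (λᵢ l i + 1)) ·q^ (2 * i + 2)

{-# OPTIONS --safe #-}
-- Number the vertices from 0. The vertex v ≥ 1 is attached to ⌊(v − 2)/d⌋ (to 0
-- if v = 1), so D_{n,d} consists of two d-ary trees rooted at 0 and 1 together
-- with the edge 01. Let e_j(v) be the number of vertices u < v at distance j
-- from v; the coefficient of q^j in W(D_{n,d}) is Σ_{v < n} e_j(v). Comparing
-- distances from v with distances from the parent p of v gives e₁(v) = 1,
-- e₂(v) = (v − 2) mod d + 1 if v ≥ 2, and e_{j+2}(v) = d e_j(p) if j ≥ 1 and
-- v ≥ 2 (for v ≤ 1 these counts vanish). Hence e_{2i+1}(v) = d^i from the
-- vertex n_i on, and e_{2i+2}(v) = d^i (c + 1) from the vertex m_i on, where c is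
-- the i-th base-d digit of the difference between the numbers of v and m_i;
-- both vanish before. Summing over v gives the two families of
-- coefficients, and the label of n agrees with n − m_i modulo d^{i+1}.
module Submission where

open import Defs
open import Data.Fin as Fin using (Fin; fromℕ; fromℕ<; inject₁; toℕ)
open import Data.Fin.Properties as Fin using (toℕ-fromℕ; toℕ-fromℕ<; toℕ-inject₁; toℕ-injective; toℕ<n; inject₁-injective; fromℕ≢inject₁)
open import Data.Fin.Relation.Unary.Top using (View; view; ‵fromℕ; ‵inject₁)
open import Data.List using ([]; _∷_; _++_; length; map; filter; tabulate; applyUpTo; upTo; allFin; cartesianProduct)
open import Data.List.Properties using (map-++; map-∘)
open import Data.Nat
open import Data.Nat.Combinatorics using (_C_; nC1≡n; nCk+nC[k+1]≡[n+1]C[k+1])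
open import Data.Nat.Divisibility using (divides)
open import Data.Nat.DivMod
open import Data.Nat.Induction using (<-wellFounded)
open import Data.Nat.ListAction using (sum)
open import Data.Nat.ListAction.Properties using (sum-++)
open import Data.Nat.Properties
open import Data.Nat.Tactic.RingSolver using (solve-∀)
open import Data.Product using (∃; ∃₂; _×_; _,_; proj₁; proj₂)
open import Data.Sum using (_⊎_; inj₁; inj₂; [_,_]′)
open import Function using (_∘_; id)
open import Induction.WellFounded using (Acc; acc)
open import Relation.Binary using (Tri; tri<; tri≈; tri>)
open import Relation.Binary.PropositionalEquality
open import Relation.Nullary using (Dec; yes; no; ¬_; contradiction)
open import Relation.Unary using (Decidable)

-- Finite sums over initial segments of the naturals and over `Fin n`.

∑ : ℕ → (ℕ → ℕ) → ℕ
∑ zero    f = 0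
∑ (suc n) f = ∑ n f + f n

∑-cong : ∀ n {f g} → (∀ i → i < n → f i ≡ g i) → ∑ n f ≡ ∑ n g
∑-cong zero    eq = refl
∑-cong (suc n) eq = cong₂ _+_ (∑-cong n (λ i i<n → eq i (m<n⇒m<1+n i<n))) (eq n ≤-refl)

∑-const : ∀ n c → ∑ n (λ _ → c) ≡ n * c
∑-const zero    c = refl
∑-const (suc n) c = trans (cong (_+ c) (∑-const n c)) (+-comm (n * c) c)

∑-≡0 : ∀ n {f} → (∀ i → i < n → f i ≡ 0) → ∑ n f ≡ 0
∑-≡0 n eq = trans (∑-cong n eq) (trans (∑-const n 0) (*-zeroʳ n))

∑-*ˡ : ∀ n c f → ∑ n (λ i → c * f i) ≡ c * ∑ n f
∑-*ˡ zero    c f = sym (*-zeroʳ c)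
∑-*ˡ (suc n) c f = trans (cong (_+ c * f n) (∑-*ˡ n c f)) (sym (*-distribˡ-+ c (∑ n f) (f n)))

∑-+ : ∀ n f g → ∑ n (λ i → f i + g i) ≡ ∑ n f + ∑ n g
∑-+ zero    f g = refl
∑-+ (suc n) f g = trans (cong (_+ (f n + g n)) (∑-+ n f g)) (lemma (∑ n f) (∑ n g) (f n) (g n))
  where
  lemma : ∀ a b x y → a + b + (x + y) ≡ a + x + (b + y)
  lemma = solve-∀

∑-swap : ∀ m n (f : ℕ → ℕ → ℕ) → ∑ m (λ i → ∑ n (f i)) ≡ ∑ n (λ j → ∑ m (λ i → f i j))
∑-swap zero    n f = sym (∑-≡0 n (λ _ _ → refl))
∑-swap (suc m) n f = trans (cong (_+ ∑ n (f m)) (∑-swap m n f)) (sym (∑-+ n _ (f m)))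

∑-split : ∀ m n f → ∑ (m + n) f ≡ ∑ m f + ∑ n (λ i → f (m + i))
∑-split m zero f rewrite +-identityʳ m = sym (+-identityʳ (∑ m f))
∑-split m (suc n) f rewrite +-suc m n = trans (cong (_+ f (m + n)) (∑-split m n f))
                                              (+-assoc (∑ m f) _ (f (m + n)))

∑-blocks : ∀ D b c f →
  ∑ (b * D + c) f ≡ ∑ b (λ a → ∑ D (λ x → f (a * D + x))) + ∑ c (λ x → f (b * D + x))
∑-blocks D b c f = trans (∑-split (b * D) c f) (cong₂ _+_ (full b) refl)
  where
  full : ∀ b → ∑ (b * D) f ≡ ∑ b (λ a → ∑ D (λ x → f (a * D + x)))
  full zero    = refl
  full (suc b) = trans (cong (λ m → ∑ m f) (+-comm D (b * D)))
                       (trans (∑-split (b * D) D f) (cong₂ _+_ (full b) refl))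

-- The case `n ≤ m` is included: then every term vanishes and the truncated `n ∸ m` is 0. This
-- covers thresholds that lie beyond the last vertex.
∑-shift : ∀ n m {f} g → (∀ i → i < m → f i ≡ 0) → (∀ i → f (m + i) ≡ g i) → ∑ n f ≡ ∑ (n ∸ m) g
∑-shift n m {f} g below above with ≤-total n m
... | inj₁ n≤m rewrite m≤n⇒m∸n≡0 n≤m = ∑-≡0 n (λ i i<n → below i (<-≤-trans i<n n≤m))
... | inj₂ m≤n = begin
  ∑ n f                                     ≡⟨ cong (λ x → ∑ x f) (m+[n∸m]≡n m≤n) ⟨
  ∑ (m + (n ∸ m)) f                         ≡⟨ ∑-split m (n ∸ m) f ⟩
  ∑ m f + ∑ (n ∸ m) (λ i → f (m + i))       ≡⟨ cong₂ _+_ (∑-≡0 m below) (∑-cong (n ∸ m) (λ i _ → above i)) ⟩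
  ∑ (n ∸ m) g                               ∎
  where open ≡-Reasoning

∑-single : ∀ n {f} i → (∀ j → j ≢ i → f j ≡ 0) → i < n → ∑ n f ≡ f i
∑-single (suc n) {f} i zeros i<n with i ≟ n
... | yes refl = cong (_+ f n) (∑-≡0 n (λ j j<n → zeros j (<⇒≢ j<n)))
... | no i≢n   = trans (cong₂ _+_ (∑-single n i zeros (≤∧≢⇒< (s≤s⁻¹ i<n) i≢n)) (zeros n (i≢n ∘ sym)))
                       (+-identityʳ (f i))

∑-suc : ∀ n f → ∑ (suc n) f ≡ f 0 + ∑ n (f ∘ suc)
∑-suc n f = ∑-split 1 n f

∑-upTo : ∀ n f → sum (map f (upTo n)) ≡ ∑ n f
∑-upTo n f = go n id
  where
  -- The tail of `applyUpTo g` is `applyUpTo (g ∘ suc)`, so the induction has to run over all `g`.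
  go : ∀ n (g : ℕ → ℕ) → sum (map f (applyUpTo g n)) ≡ ∑ n (f ∘ g)
  go zero    g = refl
  go (suc n) g = trans (cong (f (g 0) +_) (go n (g ∘ suc))) (sym (∑-suc n (f ∘ g)))

-- The last index is split off, because `attachLeaf` adds the new vertex as `fromℕ n` and keeps the
-- old ones through `inject₁`.
∑ᶠ : ∀ n → (Fin n → ℕ) → ℕ
∑ᶠ zero    f = 0
∑ᶠ (suc n) f = ∑ᶠ n (f ∘ inject₁) + f (fromℕ n)

∑ᶠ-cong : ∀ n {f g : Fin n → ℕ} → (∀ i → f i ≡ g i) → ∑ᶠ n f ≡ ∑ᶠ n g
∑ᶠ-cong zero    eq = refl
∑ᶠ-cong (suc n) eq = cong₂ _+_ (∑ᶠ-cong n (eq ∘ inject₁)) (eq (fromℕ n))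

∑ᶠ-toℕ : ∀ n f → ∑ᶠ n (f ∘ toℕ) ≡ ∑ n f
∑ᶠ-toℕ zero    f = refl
∑ᶠ-toℕ (suc n) f = cong₂ _+_
  (trans (∑ᶠ-cong n (λ i → cong f (toℕ-inject₁ i))) (∑ᶠ-toℕ n f))
  (cong f (toℕ-fromℕ n))

∑ᶠ-suc : ∀ n f → ∑ᶠ (suc n) f ≡ f Fin.zero + ∑ᶠ n (f ∘ Fin.suc)
∑ᶠ-suc zero    f = sym (+-identityʳ _)
∑ᶠ-suc (suc n) f = trans (cong₂ _+_ (∑ᶠ-suc n (f ∘ inject₁)) refl)
                         (+-assoc (f Fin.zero) _ _)

∑ᶠ-allFin : ∀ n f → sum (map f (allFin n)) ≡ ∑ᶠ n f
∑ᶠ-allFin n f = go n id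
  where
  go : ∀ m (g : Fin m → Fin n) → sum (map f (tabulate g)) ≡ ∑ᶠ m (f ∘ g)
  go zero    g = refl
  go (suc m) g = trans (cong (f (g Fin.zero) +_) (go m (g ∘ Fin.suc))) (sym (∑ᶠ-suc m (f ∘ g)))

-- Indicators, filtered lists and Cartesian products.

indicator : ∀ {A : Set} → Dec A → ℕ
indicator (yes _) = 1
indicator (no _)  = 0

indicator-yes : ∀ {A : Set} (a? : Dec A) → A → indicator a? ≡ 1
indicator-yes (yes _) a = refl
indicator-yes (no ¬a) a = contradiction a ¬a

indicator-no : ∀ {A : Set} (a? : Dec A) → ¬ A → indicator a? ≡ 0
indicator-no (yes a) ¬a = contradiction a ¬a
indicator-no (no _)  ¬a = refl

indicator-cong : ∀ {A B : Set} (a? : Dec A) (b? : Dec B) → (A → B) → (B → A) →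
                 indicator a? ≡ indicator b?
indicator-cong (yes a) b? to from = sym (indicator-yes b? (to a))
indicator-cong (no ¬a) b? to from = sym (indicator-no b? (¬a ∘ from))

module _ {A : Set} {P : A → Set} (P? : Decidable P) where

  length-filter : ∀ xs → length (filter P? xs) ≡ sum (map (indicator ∘ P?) xs)
  length-filter []       = refl
  length-filter (x ∷ xs) with P? x
  ... | yes _ = cong suc (length-filter xs)
  ... | no  _ = length-filter xs

  sum-map-filter : ∀ (f : A → ℕ) xs →
    sum (map f (filter P? xs)) ≡ sum (map (λ x → indicator (P? x) * f x) xs)
  sum-map-filter f []       = refl
  sum-map-filter f (x ∷ xs) with P? x
  ... | yes _ = cong₂ _+_ (sym (+-identityʳ (f x))) (sum-map-filter f xs)
  ... | no  _ = sum-map-filter f xs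

sum-map-cartesianProduct : ∀ {A B : Set} (f : A × B → ℕ) xs ys →
  sum (map f (cartesianProduct xs ys)) ≡ sum (map (λ x → sum (map (λ y → f (x , y)) ys)) xs)
sum-map-cartesianProduct f []       ys = refl
sum-map-cartesianProduct f (x ∷ xs) ys = begin
  sum (map f (map (x ,_) ys ++ cartesianProduct xs ys))
    ≡⟨ cong sum (map-++ f (map (x ,_) ys) _) ⟩
  sum (map f (map (x ,_) ys) ++ map f (cartesianProduct xs ys))
    ≡⟨ sum-++ (map f (map (x ,_) ys)) _ ⟩
  sum (map f (map (x ,_) ys)) + sum (map f (cartesianProduct xs ys))
    ≡⟨ cong₂ _+_ (cong sum (sym (map-∘ ys))) (sum-map-cartesianProduct f xs ys) ⟩
  sum (map (λ y → f (x , y)) ys) + sum (map (λ x → sum (map (λ y → f (x , y)) ys)) xs) ∎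
  where open ≡-Reasoning

-- Coefficients of polynomials.

coeff-⊕ : ∀ p r j → coeff (p ⊕ r) j ≡ coeff p j + coeff r j
coeff-⊕ []      r       j       = refl
coeff-⊕ (a ∷ p) []      j       = sym (+-identityʳ _)
coeff-⊕ (a ∷ p) (b ∷ r) zero    = refl
coeff-⊕ (a ∷ p) (b ∷ r) (suc j) = coeff-⊕ p r j

coeff-sumᵖ : ∀ {A : Set} (f : A → Polynomial) xs j →
  coeff (sumᵖ (map f xs)) j ≡ sum (map (λ x → coeff (f x) j) xs)
coeff-sumᵖ f []       j = refl
coeff-sumᵖ f (x ∷ xs) j = trans (coeff-⊕ (f x) _ j) (cong (coeff (f x) j +_) (coeff-sumᵖ f xs j))

coeff-·q^-≡ : ∀ c e → coeff (c ·q^ e) e ≡ c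
coeff-·q^-≡ c zero    = refl
coeff-·q^-≡ c (suc e) = coeff-·q^-≡ c e

coeff-·q^-≢ : ∀ c e j → e ≢ j → coeff (c ·q^ e) j ≡ 0
coeff-·q^-≢ c zero    zero    e≢j = contradiction refl e≢j
coeff-·q^-≢ c zero    (suc j) e≢j = refl
coeff-·q^-≢ c (suc e) zero    e≢j = refl
coeff-·q^-≢ c (suc e) (suc j) e≢j = coeff-·q^-≢ c e j (e≢j ∘ cong suc)

module _ (c e : ℕ → ℕ) (e-injective : ∀ {i j} → e i ≡ e j → i ≡ j) where

  coeff-Σᵖ-< : ∀ {m i} → i < m → coeff (Σᵖ[ i < m ] c i ·q^ e i) (e i) ≡ c i
  coeff-Σᵖ-< {m} {i} i<m = begin
    coeff (Σᵖ[ i < m ] c i ·q^ e i) (e i)                ≡⟨ coeff-sumᵖ (λ i → c i ·q^ e i) (upTo m) (e i) ⟩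
    sum (map (λ h → coeff (c h ·q^ e h) (e i)) (upTo m)) ≡⟨ ∑-upTo m _ ⟩
    ∑ m (λ h → coeff (c h ·q^ e h) (e i))                ≡⟨ ∑-single m i (λ j j≢i → coeff-·q^-≢ (c j) (e j) (e i) (j≢i ∘ e-injective)) i<m ⟩
    coeff (c i ·q^ e i) (e i)                            ≡⟨ coeff-·q^-≡ (c i) (e i) ⟩
    c i                                                  ∎
    where open ≡-Reasoning

coeff-Σᵖ-≡0 : ∀ (c e : ℕ → ℕ) m j → (∀ i → i < m → e i ≢ j) → coeff (Σᵖ[ i < m ] c i ·q^ e i) j ≡ 0
coeff-Σᵖ-≡0 c e m j e≢j = trans (coeff-sumᵖ (λ i → c i ·q^ e i) (upTo m) j)
  (trans (∑-upTo m _) (∑-≡0 m (λ i i<m → coeff-·q^-≢ (c i) (e i) j (e≢j i i<m))))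

-- Sums of functions of a quotient or a remainder.

[b*m+x]/m≡b : ∀ b m .{{_ : NonZero m}} {x} → x < m → (b * m + x) / m ≡ b
[b*m+x]/m≡b b m {x} x<m = begin
  (b * m + x) / m     ≡⟨ +-distrib-/-∣ˡ x (divides b refl) ⟩
  b * m / m + x / m   ≡⟨ cong₂ _+_ (m*n/n≡m b m) (m<n⇒m/n≡0 x<m) ⟩
  b + 0               ≡⟨ +-identityʳ b ⟩
  b                   ∎
  where open ≡-Reasoning

[b*m+x]%m≡x : ∀ b m .{{_ : NonZero m}} {x} → x < m → (b * m + x) % m ≡ x
[b*m+x]%m≡x b m {x} x<m = begin
  (b * m + x) % m   ≡⟨ cong (_% m) (+-comm (b * m) x) ⟩
  (x + b * m) % m   ≡⟨ [m+kn]%n≡m%n x b m ⟩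
  x % m             ≡⟨ m<n⇒m%n≡m x<m ⟩
  x                 ∎
  where open ≡-Reasoning

-- The quotient is constant on each block of length `m`. The last block may be full, which is why
-- `c` may equal `m`: in `earlier-2+` it has `suc (t % d)` terms.
∑-/ : ∀ m .{{_ : NonZero m}} b {c} → c ≤ m → ∀ h →
      ∑ (b * m + c) (λ t → h (t / m)) ≡ m * ∑ b h + c * h b
∑-/ m b {c} c≤m h = begin
  ∑ (b * m + c) (λ t → h (t / m))
    ≡⟨ ∑-blocks m b c _ ⟩
  ∑ b (λ a → ∑ m (λ x → h ((a * m + x) / m))) + ∑ c (λ x → h ((b * m + x) / m))
    ≡⟨ cong₂ _+_ (∑-cong b (λ a _ → block a ≤-refl)) (block b c≤m) ⟩
  ∑ b (λ a → m * h a) + c * h b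
    ≡⟨ cong (_+ c * h b) (∑-*ˡ b m h) ⟩
  m * ∑ b h + c * h b ∎
  where
  open ≡-Reasoning
  block : ∀ a {e} → e ≤ m → ∑ e (λ x → h ((a * m + x) / m)) ≡ e * h a
  block a {e} e≤m = trans
    (∑-cong e (λ x x<e → cong h ([b*m+x]/m≡b a m (<-≤-trans x<e e≤m))))
    (∑-const e (h a))

-- Over each full block the remainder runs once through all values below `m`.
∑-% : ∀ m .{{_ : NonZero m}} b {c} → c ≤ m → ∀ h →
      ∑ (b * m + c) (λ t → h (t % m)) ≡ b * ∑ m h + ∑ c h
∑-% m b {c} c≤m h = begin
  ∑ (b * m + c) (λ t → h (t % m))
    ≡⟨ ∑-blocks m b c _ ⟩
  ∑ b (λ a → ∑ m (λ x → h ((a * m + x) % m))) + ∑ c (λ x → h ((b * m + x) % m))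
    ≡⟨ cong₂ _+_ (∑-cong b (λ a _ → block a ≤-refl)) (block b c≤m) ⟩
  ∑ b (λ _ → ∑ m h) + ∑ c h
    ≡⟨ cong (_+ ∑ c h) (∑-const b (∑ m h)) ⟩
  b * ∑ m h + ∑ c h ∎
  where
  open ≡-Reasoning
  block : ∀ a {e} → e ≤ m → ∑ e (λ x → h ((a * m + x) % m)) ≡ ∑ e h
  block a {e} e≤m = ∑-cong e (λ x x<e → cong h ([b*m+x]%m≡x a m (<-≤-trans x<e e≤m)))

-- Degrees and the polynomial `W` as sums over vertices.

∑ᶠ-indicator-≟ : ∀ n (p : Fin n) → ∑ᶠ n (λ w → indicator (w Fin.≟ p)) ≡ 1
∑ᶠ-indicator-≟ n p = begin
  ∑ᶠ n (λ w → indicator (w Fin.≟ p))         ≡⟨ ∑ᶠ-cong n (λ w → indicator-cong (w Fin.≟ p) (toℕ w ≟ toℕ p) (cong toℕ) toℕ-injective) ⟩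
  ∑ᶠ n (λ w → indicator (toℕ w ≟ toℕ p))     ≡⟨ ∑ᶠ-toℕ n (λ w → indicator (w ≟ toℕ p)) ⟩
  ∑ n (λ w → indicator (w ≟ toℕ p))          ≡⟨ ∑-single n (toℕ p) (λ j j≢p → indicator-no (j ≟ toℕ p) j≢p) (toℕ<n p) ⟩
  indicator (toℕ p ≟ toℕ p)                  ≡⟨ indicator-yes (toℕ p ≟ toℕ p) refl ⟩
  1                                          ∎
  where open ≡-Reasoning

snoc : ∀ {n} {G : Graph n} {u v w ℓ} → Walk G u v ℓ → Graph.Adj G v w → Walk G u w (suc ℓ)
snoc nil        b = cons b nil
snoc (cons a w) b = cons a (snoc w b)

module _ {n : ℕ} (G : Graph n) where
  open Graph G

  degree-∑ᶠ : ∀ v → degree G v ≡ ∑ᶠ n (λ w → indicator (adj? v w))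
  degree-∑ᶠ v = trans (length-filter (adj? v) (allFin n)) (∑ᶠ-allFin n _)

  coeff-W-∑ᶠ : ∀ conn j → coeff (W G conn) j ≡
    ∑ᶠ n (λ u → ∑ᶠ n (λ v → indicator (u Fin.<? v) * coeff (1 ·q^ distance G conn u v) j))
  coeff-W-∑ᶠ conn j = begin
    coeff (W G conn) j
      ≡⟨ coeff-sumᵖ (λ (u , v) → 1 ·q^ distance G conn u v) (filter below? pairs) j ⟩
    sum (map (λ (u , v) → coeff (1 ·q^ distance G conn u v) j) (filter below? pairs))
      ≡⟨ sum-map-filter below? _ pairs ⟩
    sum (map (λ (u , v) → f u v) pairs)
      ≡⟨ sum-map-cartesianProduct (λ (u , v) → f u v) (allFin n) (allFin n) ⟩
    sum (map (λ u → sum (map (f u) (allFin n))) (allFin n))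
      ≡⟨ ∑ᶠ-allFin n (λ u → sum (map (f u) (allFin n))) ⟩
    ∑ᶠ n (λ u → sum (map (f u) (allFin n)))
      ≡⟨ ∑ᶠ-cong n (λ u → ∑ᶠ-allFin n (f u)) ⟩
    ∑ᶠ n (λ u → ∑ᶠ n (f u)) ∎
    where
    open ≡-Reasoning
    pairs = cartesianProduct (allFin n) (allFin n)
    below? : Decidable (λ ((u , v) : Fin n × Fin n) → u Fin.< v)
    below? (u , v) = u Fin.<? v
    f : Fin n → Fin n → ℕ
    f u v = indicator (u Fin.<? v) * coeff (1 ·q^ distance G conn u v) j

  module _ (p : Fin n) where

    private
      adj′? = Graph.adj? (attachLeaf G p)

      -- The endpoints are variables tied by equations, since `inject₁` is not a constructor and
      -- matching on the adjacency could not unify its values.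
      inject₁-inject₁⁻ : ∀ {i j u v} → LeafAdj G p i j → i ≡ inject₁ u → j ≡ inject₁ v → Adj u v
      inject₁-inject₁⁻ (old a) e f with refl ← inject₁-injective e | refl ← inject₁-injective f = a
      inject₁-inject₁⁻ up      e f = contradiction e fromℕ≢inject₁
      inject₁-inject₁⁻ down    e f = contradiction f fromℕ≢inject₁

      inject₁-fromℕ⁻ : ∀ {i j u} → LeafAdj G p i j → i ≡ inject₁ u → j ≡ fromℕ n → u ≡ p
      inject₁-fromℕ⁻ (old a) e f = contradiction (sym f) fromℕ≢inject₁
      inject₁-fromℕ⁻ up      e f = contradiction e fromℕ≢inject₁
      inject₁-fromℕ⁻ down    e f = sym (inject₁-injective e)

    degree-inject₁ : ∀ u → degree (attachLeaf G p) (inject₁ u) ≡ degree G u + indicator (u Fin.≟ p)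
    degree-inject₁ u = begin
      degree (attachLeaf G p) (inject₁ u)
        ≡⟨ trans (length-filter (adj′? (inject₁ u)) (allFin (suc n))) (∑ᶠ-allFin (suc n) _) ⟩
      ∑ᶠ n (λ w → indicator (adj′? (inject₁ u) (inject₁ w))) + indicator (adj′? (inject₁ u) (fromℕ n))
        ≡⟨ cong₂ _+_
             (∑ᶠ-cong n (λ w → indicator-cong (adj′? (inject₁ u) (inject₁ w)) (adj? u w) (λ a → inject₁-inject₁⁻ a refl refl) old))
             (indicator-cong (adj′? (inject₁ u) (fromℕ n)) (u Fin.≟ p) (λ a → inject₁-fromℕ⁻ a refl refl) (λ { refl → down })) ⟩
      ∑ᶠ n (λ w → indicator (adj? u w)) + indicator (u Fin.≟ p)
        ≡⟨ cong (_+ indicator (u Fin.≟ p)) (degree-∑ᶠ u) ⟨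
      degree G u + indicator (u Fin.≟ p) ∎
      where open ≡-Reasoning

    degree-fromℕ : degree (attachLeaf G p) (fromℕ n) ≡ 1
    degree-fromℕ = begin
      degree (attachLeaf G p) (fromℕ n)
        ≡⟨ trans (length-filter (adj′? (fromℕ n)) (allFin (suc n))) (∑ᶠ-allFin (suc n) _) ⟩
      ∑ᶠ n (λ w → indicator (adj′? (fromℕ n) (inject₁ w))) + indicator (adj′? (fromℕ n) (fromℕ n))
        ≡⟨ cong₂ _+_
             (∑ᶠ-cong n (λ w → indicator-cong (adj′? (fromℕ n) (inject₁ w)) (w Fin.≟ p)
               (λ a → inject₁-fromℕ⁻ (Graph.adj-sym (attachLeaf G p) a) refl refl) (λ { refl → up })))
             (indicator-no (adj′? (fromℕ n) (fromℕ n)) (Graph.adj-irrefl (attachLeaf G p) refl)) ⟩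
      ∑ᶠ n (λ w → indicator (w Fin.≟ p)) + 0
        ≡⟨ trans (+-identityʳ _) (∑ᶠ-indicator-≟ n p) ⟩
      1 ∎
      where open ≡-Reasoning

-- Parity of exponents and triangular numbers.

zero-odd-even : ∀ j → (j ≡ 0) ⊎ (∃ λ i → j ≡ 2 * i + 1) ⊎ (∃ λ i → j ≡ 2 * i + 2)
zero-odd-even zero = inj₁ refl
zero-odd-even (suc j) with zero-odd-even j
... | inj₁ refl              = inj₂ (inj₁ (0 , refl))
... | inj₂ (inj₁ (i , refl)) = inj₂ (inj₂ (i , sym (+-suc (2 * i) 1)))
... | inj₂ (inj₂ (i , refl)) = inj₂ (inj₁ (suc i , next i))
  where
  next : ∀ i → suc (2 * i + 2) ≡ 2 * suc i + 1
  next = solve-∀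

2i+1≢2j+2 : ∀ i j → 2 * i + 1 ≢ 2 * j + 2
2i+1≢2j+2 i j eq = even≢odd (suc j) i (begin
  2 * suc j      ≡⟨ trans (*-suc 2 j) (+-comm 2 (2 * j)) ⟩
  2 * j + 2      ≡⟨ eq ⟨
  2 * i + 1      ≡⟨ +-comm (2 * i) 1 ⟩
  suc (2 * i)    ∎)
  where open ≡-Reasoning

-- Pascal's rule adds the summand `suc n`, written as `suc n C 1`.
∑-suc≡C : ∀ n → ∑ n suc ≡ (n + 1) C 2
∑-suc≡C zero    = refl
∑-suc≡C (suc n) = begin
  ∑ n suc + suc n              ≡⟨ cong₂ _+_ (trans (∑-suc≡C n) (cong (_C 2) (+-comm n 1))) (sym (nC1≡n (suc n))) ⟩
  suc n C 2 + suc n C 1        ≡⟨ +-comm (suc n C 2) (suc n C 1) ⟩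
  suc n C 1 + suc n C 2        ≡⟨ nCk+nC[k+1]≡[n+1]C[k+1] (suc n) 1 ⟩
  suc (suc n) C 2              ≡⟨ cong (λ m → suc m C 2) (+-comm 1 n) ⟩
  (suc n + 1) C 2              ∎
  where open ≡-Reasoning

-- The parent map and the recursive distance.

module Dendrimer (d : ℕ) .{{_ : NonTrivial d}} where

  instance
    d≢0 : NonZero d
    d≢0 = nonTrivial⇒nonZero d

  d^≢0 : ∀ i → NonZero (d ^ i)
  d^≢0 i = m^n≢0 d i

  -- The truncated subtraction makes 0 the parent of 1 as well, so that every
  -- vertex u, including 0, has exactly the d children d u + 2, …, d u + d + 1
  -- among the vertices ≥ 2.
  parent : ℕ → ℕ
  parent v = (v ∸ 2) / d

  parent-< : ∀ v → parent (suc v) < suc v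
  parent-< v = s≤s (≤-trans (m/n≤m (v ∸ 1) d) (m∸n≤m v 1))

  -- The larger vertex is replaced by its parent until the two agree. Each move lowers `u + v`, so
  -- this sum is enough fuel; if it is 0, both vertices are 0 and the default value 0 is correct.
  δ′ : (fuel : ℕ) → ℕ → ℕ → ℕ
  δ′ zero       u v = 0
  δ′ (suc fuel) u v with <-cmp u v
  ... | tri< _ _ _ = suc (δ′ fuel u (parent v))
  ... | tri≈ _ _ _ = 0
  ... | tri> _ _ _ = suc (δ′ fuel (parent u) v)

  parent-decreases : ∀ u {v f} → 0 < v → u + v ≤ suc f → u + parent v ≤ f
  parent-decreases u {suc v} _ le = ≤-trans (+-monoʳ-≤ u (s≤s⁻¹ (parent-< v)))
    (s≤s⁻¹ (≤-trans (≤-reflexive (sym (+-suc u v))) le))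

  parent-decreasesˡ : ∀ {u} v {f} → 0 < u → u + v ≤ suc f → parent u + v ≤ f
  parent-decreasesˡ {u} v {f} 0<u le = subst (_≤ f) (+-comm v (parent u))
    (parent-decreases v 0<u (subst (_≤ suc f) (+-comm u v) le))

  -- Frees the recursion equations `δ-<` and `δ->` from fuel: one unfolding of `δ` may leave more
  -- fuel than the sum of the new arguments.
  δ′-fuel : ∀ f g u v → u + v ≤ f → u + v ≤ g → δ′ f u v ≡ δ′ g u v
  δ′-fuel zero    zero    u    v    _ _ = refl
  δ′-fuel zero    (suc g) zero zero _ _ = refl
  δ′-fuel (suc f) zero    zero zero _ _ = refl
  δ′-fuel (suc f) (suc g) u    v    p q with <-cmp u v
  ... | tri< u<v _ _ = cong suc (δ′-fuel f g u (parent v)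
          (parent-decreases u (m<n⇒0<n u<v) p) (parent-decreases u (m<n⇒0<n u<v) q))
  ... | tri≈ _ _ _ = refl
  ... | tri> _ _ v<u = cong suc (δ′-fuel f g (parent u) v
          (parent-decreasesˡ v (m<n⇒0<n v<u) p) (parent-decreasesˡ v (m<n⇒0<n v<u) q))

  δ : ℕ → ℕ → ℕ
  δ u v = δ′ (u + v) u v

  δ-refl : ∀ u → δ u u ≡ 0
  δ-refl zero = refl
  δ-refl (suc u) with <-cmp (suc u) (suc u)
  ... | tri< u<u _ _ = contradiction u<u (<-irrefl refl)
  ... | tri≈ _ _ _   = refl
  ... | tri> _ _ u<u = contradiction u<u (<-irrefl refl)

  δ-< : ∀ {u v} → u < v → δ u v ≡ suc (δ u (parent v))
  -- Moving the successor to the front of `u + suc v` exposes the constructor on which `δ′` unfolds.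
  δ-< {u} {suc v} u<v = trans (cong (λ f → δ′ f u (suc v)) (+-suc u v)) step
    where
    step : δ′ (suc (u + v)) u (suc v) ≡ suc (δ u (parent (suc v)))
    step with <-cmp u (suc v)
    ... | tri< _ _ _   = cong suc (δ′-fuel _ _ u (parent (suc v))
                           (parent-decreases u z<s (≤-reflexive (+-suc u v))) ≤-refl)
    ... | tri≈ u≮v _ _ = contradiction u<v u≮v
    ... | tri> u≮v _ _ = contradiction u<v u≮v

  δ-> : ∀ {u v} → v < u → δ u v ≡ suc (δ (parent u) v)
  δ-> {suc u} {v} v<u with <-cmp (suc u) v
  ... | tri< _ _ v≮u = contradiction v<u v≮u
  ... | tri≈ _ _ v≮u = contradiction v<u v≮u
  ... | tri> _ _ _   = cong suc (δ′-fuel _ _ (parent (suc u)) v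
                         (parent-decreasesˡ {suc u} v z<s ≤-refl) ≤-refl)

  -- Apart from the ancestors of v, a vertex u has distance 2 + δ (parent u)
  -- (parent v) from v; replacing each ancestor by the one two steps below it
  -- shows that the two families of distances agree up to one extra 1.
  ∑-δ : ∀ v (g : ℕ → ℕ) →
        ∑ (suc v) (λ u → g (δ u (suc v))) ≡ g 1 + ∑ v (λ t → g (2 + δ (t / d) (parent (suc v))))
  ∑-δ v = go v (<-wellFounded v)
    where
    open ≡-Reasoning
    go : ∀ v → Acc _<_ v → (g : ℕ → ℕ) →
         ∑ (suc v) (λ u → g (δ u (suc v))) ≡ g 1 + ∑ v (λ t → g (2 + δ (t / d) (parent (suc v))))
    go zero    _        g = sym (+-identityʳ (g 1))
    go (suc t) (acc rs) g = trans
      (∑-cong (2 + t) (λ u u<v → cong g (δ-< u<v)))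
      (step (t / d) refl)
      where
      step : ∀ p → t / d ≡ p →
        ∑ (2 + t) (λ u → g (suc (δ u p))) ≡ g 1 + ∑ (suc t) (λ s → g (2 + δ (s / d) p))
      -- As `t / d` is 0, so are `parent (suc u)` and `u / d` for all `u ≤ t`, and the sums agree
      -- term by term.
      step zero eq = begin
        ∑ (2 + t) (λ u → g (suc (δ u 0)))
          ≡⟨ ∑-suc (suc t) _ ⟩
        g 1 + ∑ (suc t) (λ u → g (suc (δ (suc u) 0)))
          ≡⟨ cong (g 1 +_) (∑-cong (suc t) λ u u<t → cong (g ∘ suc) (begin
               δ (suc u) 0                ≡⟨ δ-> {suc u} z<s ⟩
               suc (δ (parent (suc u)) 0) ≡⟨ cong (λ w → suc (δ w 0)) (trans (vanish (≤-trans (m∸n≤m u 1) (s≤s⁻¹ u<t))) (sym (vanish (s≤s⁻¹ u<t)))) ⟩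
               suc (δ (u / d) 0)          ∎)) ⟩
        g 1 + ∑ (suc t) (λ s → g (2 + δ (s / d) 0)) ∎
        where
        vanish : ∀ {s} → s ≤ t → s / d ≡ 0
        vanish s≤t = n≤0⇒n≡0 (≤-trans (/-monoˡ-≤ d s≤t) (≤-reflexive eq))
      -- The range is cut into the vertices below `p`, the vertex `p` and the `r` vertices above it.
      -- Induction at `q` with `g ∘ suc` treats the first; above `p`, one move to the parent turns
      -- `suc p + x` into `(q + x) / d`.
      step p@(suc q) eq = begin
        ∑ (2 + t) h
          ≡⟨ cong (λ x → ∑ (2 + x) h) (sym (m+[n∸m]≡n q≤t)) ⟩
        ∑ (suc p + r) h
          ≡⟨ ∑-split (suc p) r h ⟩
        ∑ p h + h p + ∑ r (λ x → h (suc p + x))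
          ≡⟨ cong₂ _+_ (cong₂ _+_ (go q (rs (s≤s q≤t)) (g ∘ suc)) (cong (g ∘ suc) (δ-refl p)))
               (∑-cong r λ x _ → cong (g ∘ suc) (δ-> (s≤s (m≤m+n p x)))) ⟩
        g 2 + ∑ q (λ s → g (3 + δ (s / d) (parent p))) + g 1 + ∑ r (λ x → k (q + x))
          ≡⟨ cong (λ y → g 2 + y + g 1 + ∑ r (λ x → k (q + x))) (∑-cong q λ s s<q →
               cong (g ∘ suc ∘ suc) (sym (δ-< (s≤s (≤-trans (m/n≤m s d) (<⇒≤ s<q)))))) ⟩
        g 2 + ∑ q k + g 1 + ∑ r (λ x → k (q + x))
          ≡⟨ rearrange (g 2) (∑ q k) (g 1) _ ⟩
        g 1 + (∑ q k + ∑ r (λ x → k (q + x)) + g 2)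
          ≡⟨ cong (λ y → g 1 + (y + g 2)) (sym (∑-split q r k)) ⟩
        g 1 + (∑ (q + r) k + g 2)
          -- The `g 2` left over by the induction is the term for `t`, because `t / d` is `p` and
          -- `δ p p` is 0.
          ≡⟨ cong₂ (λ x y → g 1 + (∑ x k + y)) (m+[n∸m]≡n q≤t)
               (cong (g ∘ suc ∘ suc) (sym (trans (cong (λ w → δ w p) eq) (δ-refl p)))) ⟩
        g 1 + (∑ t k + k t) ∎
        where
        q≤t : q ≤ t
        q≤t = ≤-trans (n≤1+n q) (≤-trans (≤-reflexive (sym eq)) (m/n≤m t d))
        r = t ∸ q
        h k : ℕ → ℕ
        h u = g (suc (δ u p))
        k s = g (2 + δ (s / d) p)
        rearrange : ∀ a b c e → a + b + c + e ≡ c + (b + e + a)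
        rearrange = solve-∀

  -- Recursion for the number of earlier vertices at a given distance.

  -- The number of vertices u < v at distance j from v.
  earlier : ℕ → ℕ → ℕ
  earlier j v = ∑ v (λ u → coeff (1 ·q^ δ u v) j)

  earlier-zero : ∀ v → earlier 0 v ≡ 0
  earlier-zero v = ∑-≡0 v (λ u u<v → cong (λ e → coeff (1 ·q^ e) 0) (δ-< u<v))

  -- Only the extra distance 1 in `∑-δ` contributes; the other distances there are at least 2.
  earlier-one : ∀ v → earlier 1 (suc v) ≡ 1
  earlier-one v = trans (∑-δ v (λ e → coeff (1 ·q^ e) 1)) (cong suc (∑-≡0 v (λ _ _ → refl)))

  -- The `suc t` terms supplied by `∑-δ` form blocks of constant `s / d`: `d` terms for each
  -- `w < t / d`, and `suc (t % d)` terms for `t / d`, whose distance from itself is 0.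
  earlier-2+ : ∀ j t →
    earlier (2 + j) (2 + t) ≡ d * earlier j (t / d) + suc (t % d) * coeff (1 ·q^ 0) j
  earlier-2+ j t = begin
    earlier (2 + j) (2 + t)
      ≡⟨ ∑-δ (suc t) (λ e → coeff (1 ·q^ e) (2 + j)) ⟩
    ∑ (suc t) (λ s → h (s / d))
      ≡⟨ cong (λ x → ∑ x (λ s → h (s / d))) (begin
           suc t                       ≡⟨ cong suc (m≡m%n+[m/n]*n t d) ⟩
           suc (t % d) + (t / d) * d   ≡⟨ +-comm (suc (t % d)) _ ⟩
           (t / d) * d + suc (t % d)   ∎) ⟩
    ∑ ((t / d) * d + suc (t % d)) (λ s → h (s / d))
      ≡⟨ ∑-/ d (t / d) (m%n<n t d) h ⟩
    d * ∑ (t / d) h + suc (t % d) * h (t / d)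
      ≡⟨ cong (λ e → d * ∑ (t / d) h + suc (t % d) * coeff (1 ·q^ e) j) (δ-refl (t / d)) ⟩
    d * earlier j (t / d) + suc (t % d) * coeff (1 ·q^ 0) j ∎
    where
    open ≡-Reasoning
    h : ℕ → ℕ
    h w = coeff (1 ·q^ δ w (t / d)) j

  earlier-3+ : ∀ j t → earlier (3 + j) (2 + t) ≡ d * earlier (1 + j) (t / d)
  earlier-3+ j t = trans (earlier-2+ (suc j) t)
    (trans (cong (d * earlier (1 + j) (t / d) +_) (*-zeroʳ (suc (t % d)))) (+-identityʳ _))

  -- Degrees in the dendrimer and the vertex receiving the next leaf.

  attach : ∀ n → Fin (suc n)
  attach n = proj₁ (leastFin (λ v → degree (dendrimer d (suc n)) v ≤? d)
                     (proj₁ (attachable d (suc n))) (proj₂ (attachable d (suc n))))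

  attach-degree : ∀ n → degree (dendrimer d (suc n)) (attach n) ≤ d
  attach-degree n = proj₁ (proj₂ (leastFin (λ v → degree (dendrimer d (suc n)) v ≤? d)
                     (proj₁ (attachable d (suc n))) (proj₂ (attachable d (suc n)))))

  attach-least : ∀ n u → degree (dendrimer d (suc n)) u ≤ d → toℕ (attach n) ≤ toℕ u
  attach-least n = proj₂ (proj₂ (leastFin (λ v → degree (dendrimer d (suc n)) v ≤? d)
                     (proj₁ (attachable d (suc n))) (proj₂ (attachable d (suc n)))))

  m≡d*[m/d]+m%d : ∀ m → m ≡ d * (m / d) + m % d
  m≡d*[m/d]+m%d m = begin
    m                        ≡⟨ m≡m%n+[m/n]*n m d ⟩
    m % d + m / d * d        ≡⟨ +-comm (m % d) _ ⟩
    m / d * d + m % d        ≡⟨ cong (_+ m % d) (*-comm (m / d) d) ⟩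
    d * (m / d) + m % d      ∎
    where open ≡-Reasoning

  m∸d*[m/d]≡m%d : ∀ m → m ∸ d * (m / d) ≡ m % d
  m∸d*[m/d]≡m%d m = trans (cong (_∸ d * (m / d)) (m≡d*[m/d]+m%d m)) (m+n∸m≡n (d * (m / d)) (m % d))

  -- `d ⊓ (m ∸ d * a)` is the number of children of `a` among the vertices 2, ..., m + 1. Below
  -- `m / d` all `d` children are present.
  full-⊓ : ∀ {a m} → a < m / d → d ⊓ (m ∸ d * a) ≡ d
  full-⊓ {a} {m} a<q = m≤n⇒m⊓n≡m (m+n≤o⇒m≤o∸n d (begin
    d + d * a    ≡⟨ *-suc d a ⟨
    d * suc a    ≡⟨ *-comm d (suc a) ⟩
    suc a * d    ≤⟨ *-monoˡ-≤ d a<q ⟩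
    m / d * d    ≤⟨ m/n*n≤m m d ⟩
    m            ∎))
    where open ≤-Reasoning

  empty-∸ : ∀ {a m} → m / d < a → suc m ∸ d * a ≡ 0
  empty-∸ {a} {m} q<a = m≤n⇒m∸n≡0 (begin
    suc m                        ≡⟨ cong suc (m≡d*[m/d]+m%d m) ⟩
    suc (d * (m / d) + m % d)    ≡⟨ +-suc _ (m % d) ⟨
    d * (m / d) + suc (m % d)    ≤⟨ +-monoʳ-≤ _ (m%n<n m d) ⟩
    d * (m / d) + d              ≡⟨ trans (+-comm _ d) (sym (*-suc d (m / d))) ⟩
    d * suc (m / d)              ≤⟨ *-monoʳ-≤ d q<a ⟩
    d * a                        ∎)
    where open ≤-Reasoning

  -- The vertex `2 + m` joins the children of `m / d` and of no other vertex.
  ⊓-suc : ∀ m a → d ⊓ (suc m ∸ d * a) ≡ d ⊓ (m ∸ d * a) + indicator (a ≟ m / d)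
  ⊓-suc m a with <-cmp a (m / d)
  ... | tri< a<q a≢q _ = begin
    d ⊓ (suc m ∸ d * a)                             ≡⟨ full-⊓ (<-≤-trans a<q (/-monoˡ-≤ d (n≤1+n m))) ⟩
    d                                               ≡⟨ +-identityʳ d ⟨
    d + 0                                           ≡⟨ cong₂ _+_ (full-⊓ a<q) (indicator-no (a ≟ m / d) a≢q) ⟨
    d ⊓ (m ∸ d * a) + indicator (a ≟ m / d)         ∎
    where open ≡-Reasoning
  ... | tri> _ a≢q q<a = begin
    d ⊓ (suc m ∸ d * a)                             ≡⟨ cong (d ⊓_) (empty-∸ q<a) ⟩
    d ⊓ 0                                           ≡⟨ +-identityʳ _ ⟨
    d ⊓ 0 + 0                                       ≡⟨ cong₂ (λ x y → d ⊓ x + y) (n≤0⇒n≡0 (≤-trans (∸-monoˡ-≤ (d * a) (n≤1+n m)) (≤-reflexive (empty-∸ q<a)))) (indicator-no (a ≟ m / d) a≢q) ⟨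
    d ⊓ (m ∸ d * a) + indicator (a ≟ m / d)         ∎
    where open ≡-Reasoning
  ... | tri≈ _ refl _ = begin
    d ⊓ (suc m ∸ d * (m / d))                       ≡⟨ cong (d ⊓_) (+-∸-assoc 1 (≤-trans (≤-reflexive (*-comm d (m / d))) (m/n*n≤m m d))) ⟩
    d ⊓ suc (m ∸ d * (m / d))                       ≡⟨ cong (λ c → d ⊓ suc c) (m∸d*[m/d]≡m%d m) ⟩
    d ⊓ suc (m % d)                                 ≡⟨ m≥n⇒m⊓n≡n (m%n<n m d) ⟩
    suc (m % d)                                     ≡⟨ +-comm 1 (m % d) ⟩
    m % d + 1                                       ≡⟨ cong (_+ 1) (m≥n⇒m⊓n≡n (<⇒≤ (m%n<n m d))) ⟨
    d ⊓ (m % d) + 1                                 ≡⟨ cong₂ (λ x y → d ⊓ x + y) (m∸d*[m/d]≡m%d m) (indicator-yes (m / d ≟ m / d) refl) ⟨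
    d ⊓ (m ∸ d * (m / d)) + indicator (m / d ≟ m / d) ∎
    where open ≡-Reasoning

  -- Every vertex below `m / d` has degree `d + 1`, whereas `m / d` has only `m % d` children and
  -- hence degree at most `d`.
  attach-from-degree : ∀ m →
    (∀ u → degree (dendrimer d (2 + m)) u ≡ suc (d ⊓ (m ∸ d * toℕ u))) →
    toℕ (attach (suc m)) ≡ m / d
  attach-from-degree m deg = ≤-antisym upper lower
    where
    q<2+m : m / d < 2 + m
    q<2+m = s≤s (m≤n⇒m≤1+n (m/n≤m m d))

    upper : toℕ (attach (suc m)) ≤ m / d
    upper = ≤-trans (attach-least (suc m) (fromℕ< q<2+m) (begin
      degree (dendrimer d (2 + m)) (fromℕ< q<2+m)   ≡⟨ deg (fromℕ< q<2+m) ⟩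
      suc (d ⊓ (m ∸ d * toℕ (fromℕ< q<2+m)))        ≤⟨ s≤s (m⊓n≤n d _) ⟩
      suc (m ∸ d * toℕ (fromℕ< q<2+m))              ≡⟨ cong (λ a → suc (m ∸ d * a)) (toℕ-fromℕ< q<2+m) ⟩
      suc (m ∸ d * (m / d))                         ≡⟨ cong suc (m∸d*[m/d]≡m%d m) ⟩
      suc (m % d)                                   ≤⟨ m%n<n m d ⟩
      d                                             ∎))
      (≤-reflexive (toℕ-fromℕ< q<2+m))
      where open ≤-Reasoning

    lower : m / d ≤ toℕ (attach (suc m))
    lower = ≮⇒≥ λ a<q → 1+n≰n (≤-trans
      (≤-reflexive (sym (trans (deg (attach (suc m))) (cong suc (full-⊓ a<q)))))
      (attach-degree (suc m)))

  -- The successor counts the edge to the parent, or for vertex 0 the edge to 1. In the induction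
  -- the degrees determine where the next leaf goes, and its place determines the new degrees.
  degree-dendrimer : ∀ m u → degree (dendrimer d (2 + m)) u ≡ suc (d ⊓ (m ∸ d * toℕ u))
  degree-dendrimer zero u = trans (one u) (cong suc (sym (trans (cong (d ⊓_) (0∸n≡0 (d * toℕ u))) (⊓-zeroʳ d))))
    where
    one : ∀ u → degree (dendrimer d 2) u ≡ 1
    one Fin.zero             = refl
    one (Fin.suc Fin.zero)   = refl
  degree-dendrimer (suc m) u = byView (view u)
    where
    open ≡-Reasoning
    attach≡ : toℕ (attach (suc m)) ≡ m / d
    attach≡ = attach-from-degree m (degree-dendrimer m)

    empty : suc m ∸ d * toℕ (fromℕ (2 + m)) ≡ 0
    empty = empty-∸ (≤-trans (s≤s (m/n≤m m d)) (≤-trans (n≤1+n (suc m)) (≤-reflexive (sym (toℕ-fromℕ (2 + m))))))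

    byView : ∀ {u} → View u → degree (dendrimer d (3 + m)) u ≡ suc (d ⊓ (suc m ∸ d * toℕ u))
    byView ‵fromℕ = trans (degree-fromℕ (dendrimer d (2 + m)) (attach (suc m)))
      (cong suc (sym (trans (cong (d ⊓_) empty) (⊓-zeroʳ d))))
    byView (‵inject₁ u′) = begin
      degree (dendrimer d (3 + m)) (inject₁ u′)
        ≡⟨ degree-inject₁ (dendrimer d (2 + m)) (attach (suc m)) u′ ⟩
      degree (dendrimer d (2 + m)) u′ + indicator (u′ Fin.≟ attach (suc m))
        ≡⟨ cong₂ _+_ (degree-dendrimer m u′) (indicator-cong (u′ Fin.≟ attach (suc m)) (toℕ u′ ≟ m / d)
             (λ e → trans (cong toℕ e) attach≡)
             (λ e → toℕ-injective (trans e (sym attach≡)))) ⟩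
      suc (d ⊓ (m ∸ d * toℕ u′) + indicator (toℕ u′ ≟ m / d))
        ≡⟨ cong suc (⊓-suc m (toℕ u′)) ⟨
      suc (d ⊓ (suc m ∸ d * toℕ u′))
        ≡⟨ cong (λ a → suc (d ⊓ (suc m ∸ d * a))) (toℕ-inject₁ u′) ⟨
      suc (d ⊓ (suc m ∸ d * toℕ (inject₁ u′))) ∎

  toℕ-attach : ∀ n → toℕ (attach n) ≡ parent (suc n)
  toℕ-attach zero    = sym (0/n≡0 d)
  toℕ-attach (suc m) = attach-from-degree m (degree-dendrimer m)

  -- The graph distance is the recursive distance.

  -- Positivity excludes 0, which `parent` maps to itself.
  Child : ℕ → ℕ → Set
  Child u v = 0 < u × v ≡ parent u

  adj⇒child : ∀ n {i j} → Graph.Adj (dendrimer d (suc n)) i j →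
              Child (toℕ i) (toℕ j) ⊎ Child (toℕ j) (toℕ i)
  adj⇒child (suc n) (old {u} {v} a) rewrite toℕ-inject₁ u | toℕ-inject₁ v = adj⇒child n a
  adj⇒child (suc n) up   rewrite toℕ-fromℕ n | toℕ-inject₁ (attach n) = inj₁ (z<s , toℕ-attach n)
  adj⇒child (suc n) down rewrite toℕ-fromℕ n | toℕ-inject₁ (attach n) = inj₂ (z<s , toℕ-attach n)

  child⇒adj : ∀ n i j → Child (toℕ i) (toℕ j) → Graph.Adj (dendrimer d (suc n)) i j
  child⇒adj zero    Fin.zero j (() , _)
  child⇒adj (suc n) i j (0<i , j≡p) with view i | view j
  ... | ‵fromℕ | _ = subst (LeafAdj _ _ (fromℕ (suc n)))
    (toℕ-injective (begin
      toℕ (inject₁ (attach n))      ≡⟨ toℕ-inject₁ (attach n) ⟩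
      toℕ (attach n)                ≡⟨ toℕ-attach n ⟩
      parent (suc n)                ≡⟨ cong parent (toℕ-fromℕ (suc n)) ⟨
      parent (toℕ (fromℕ (suc n)))  ≡⟨ j≡p ⟨
      toℕ j                         ∎))
    up
    where open ≡-Reasoning
  ... | ‵inject₁ u | ‵inject₁ v = old (child⇒adj n u v
    (subst (0 <_) (toℕ-inject₁ u) 0<i , trans (sym (toℕ-inject₁ v)) (trans j≡p (cong parent (toℕ-inject₁ u)))))
  -- The newest vertex has the largest number, and a parent is smaller than its child.
  ... | ‵inject₁ u | ‵fromℕ = contradiction j≡p (>⇒≢ (begin-strict
    parent (toℕ (inject₁ u))   <⟨ parent-<′ 0<i ⟩
    toℕ (inject₁ u)            ≡⟨ toℕ-inject₁ u ⟩
    toℕ u                      <⟨ toℕ<n u ⟩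
    suc n                      ≡⟨ toℕ-fromℕ (suc n) ⟨
    toℕ (fromℕ (suc n))        ∎))
    where
    open ≤-Reasoning
    parent-<′ : ∀ {v} → 0 < v → parent v < v
    parent-<′ {suc v} _ = parent-< v

  -- If `suc u < v`, then both `suc u` and its parent lie below `v`, so both distances pass to the
  -- parent of `v` and the induction applies. The other two cases follow from the recursion for `δ`.
  δ-parent : ∀ u v → δ (suc u) v ≤ suc (δ (parent (suc u)) v) × δ (parent (suc u)) v ≤ suc (δ (suc u) v)
  δ-parent u v = go v (<-wellFounded v)
    where
    go : ∀ v → Acc _<_ v →
         δ (suc u) v ≤ suc (δ (parent (suc u)) v) × δ (parent (suc u)) v ≤ suc (δ (suc u) v)
    go v (acc rs) = byCmp v rs (<-cmp (suc u) v)
      where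
      byCmp : ∀ v → (∀ {y} → y < v → Acc _<_ y) → Tri (suc u < v) (suc u ≡ v) (v < suc u) →
              δ (suc u) v ≤ suc (δ (parent (suc u)) v) × δ (parent (suc u)) v ≤ suc (δ (suc u) v)
      byCmp v rs (tri> _ _ v<u) rewrite δ-> {suc u} v<u = ≤-refl , m≤n⇒m≤1+n (n≤1+n _)
      byCmp v rs (tri≈ _ refl _) rewrite δ-< (parent-< u) | δ-refl (parent (suc u)) | δ-refl (suc u) = z≤n , ≤-refl
      byCmp (suc v) rs (tri< u<v _ _)
        rewrite δ-< u<v | δ-< (<-trans (parent-< u) u<v)
        with le , ge ← go (parent (suc v)) (rs (parent-< v)) = s≤s le , s≤s ge

  module _ (n : ℕ) where

    private
      D = dendrimer d (suc n)

    -- By `δ-parent` each edge changes the distance to `j` by at most 1, and the walk ends at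
    -- distance 0.
    δ-≤-length : ∀ {i j ℓ} → Walk D i j ℓ → δ (toℕ i) (toℕ j) ≤ ℓ
    δ-≤-length {i} nil = ≤-reflexive (δ-refl (toℕ i))
    δ-≤-length {i} {j} (cons {w = w} a p) = ≤-trans (lipschitz (adj⇒child n a)) (s≤s (δ-≤-length p))
      where
      lipschitz : ∀ {u w} → Child u w ⊎ Child w u → δ u (toℕ j) ≤ suc (δ w (toℕ j))
      lipschitz (inj₁ (s≤s {n = u} _ , refl)) = proj₁ (δ-parent u (toℕ j))
      lipschitz (inj₂ (s≤s {n = w} _ , refl)) = proj₂ (δ-parent w (toℕ j))

    parentᶠ : Fin (suc n) → Fin (suc n)
    parentᶠ Fin.zero      = Fin.zero
    parentᶠ i@(Fin.suc _) = fromℕ< (<-trans (parent-< _) (toℕ<n i))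

    toℕ-parentᶠ : ∀ i → toℕ (parentᶠ i) ≡ parent (toℕ i)
    toℕ-parentᶠ Fin.zero      = sym (0/n≡0 d)
    toℕ-parentᶠ i@(Fin.suc _) = toℕ-fromℕ< (<-trans (parent-< _) (toℕ<n i))

    -- The walk follows the recursion of `δ`, climbing from the larger end; `f` bounds the falling
    -- sum of the endpoints.
    δ-walk : ∀ f i j → toℕ i + toℕ j ≤ f → Walk D i j (δ (toℕ i) (toℕ j))
    δ-walk f i j le with <-cmp (toℕ i) (toℕ j)
    δ-walk f i j le | tri≈ _ i≡j _ with refl ← toℕ-injective i≡j =
      subst (Walk D i i) (sym (δ-refl (toℕ i))) nil
    δ-walk zero i j le | tri< i<j _ _ = contradiction (≤-trans (m≤n+m (toℕ j) (toℕ i)) le) (<⇒≱ (m<n⇒0<n i<j))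
    δ-walk zero i j le | tri> _ _ j<i = contradiction (≤-trans (m≤m+n (toℕ i) (toℕ j)) le) (<⇒≱ (m<n⇒0<n j<i))
    δ-walk (suc f) i j le | tri< i<j _ _ = subst (Walk D i j)
      (sym (trans (δ-< i<j) (cong (λ w → suc (δ (toℕ i) w)) (sym (toℕ-parentᶠ j)))))
      (snoc (δ-walk f i (parentᶠ j) (subst (λ w → toℕ i + w ≤ f) (sym (toℕ-parentᶠ j)) (parent-decreases (toℕ i) (m<n⇒0<n i<j) le)))
            (Graph.adj-sym D (child⇒adj n j (parentᶠ j) (m<n⇒0<n i<j , toℕ-parentᶠ j))))
    δ-walk (suc f) i j le | tri> _ _ j<i = subst (Walk D i j)
      (sym (trans (δ-> j<i) (cong (λ w → suc (δ w (toℕ j))) (sym (toℕ-parentᶠ i)))))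
      (cons (child⇒adj n i (parentᶠ i) (m<n⇒0<n j<i , toℕ-parentᶠ i))
            (δ-walk f (parentᶠ i) j (subst (λ w → w + toℕ j ≤ f) (sym (toℕ-parentᶠ i)) (parent-decreasesˡ (toℕ j) (m<n⇒0<n j<i) le))))

    distance-δ : ∀ conn i j → distance D conn i j ≡ δ (toℕ i) (toℕ j)
    distance-δ conn i j with least (walk? D i j) (proj₁ (conn i j)) (proj₂ (conn i j))
    ... | _ , walk , min = ≤-antisym (min _ (δ-walk _ i j ≤-refl)) (δ-≤-length walk)

    -- Exchanging the sums groups the pairs by their larger vertex; the indicator then cuts the
    -- inner range down to `u < v`.
    coeff-W : ∀ conn j → coeff (W D conn) j ≡ ∑ (suc n) (earlier j)
    coeff-W conn j = begin
      coeff (W D conn) j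
        ≡⟨ coeff-W-∑ᶠ D conn j ⟩
      ∑ᶠ N (λ u → ∑ᶠ N (λ v → indicator (u Fin.<? v) * coeff (1 ·q^ distance D conn u v) j))
        ≡⟨ ∑ᶠ-cong N (λ u → trans
             (∑ᶠ-cong N (λ v → cong₂ (λ x e → x * coeff (1 ·q^ e) j)
               (indicator-cong (u Fin.<? v) (toℕ u <? toℕ v) id id)
               (distance-δ conn u v)))
             (∑ᶠ-toℕ N (f (toℕ u)))) ⟩
      ∑ᶠ N (λ u → ∑ N (f (toℕ u)))
        ≡⟨ ∑ᶠ-toℕ N (λ u → ∑ N (f u)) ⟩
      ∑ N (λ u → ∑ N (f u))
        ≡⟨ ∑-swap N N f ⟩
      ∑ N (λ v → ∑ N (λ u → f u v))
        ≡⟨ ∑-cong N (λ v v<N → restrict v (<⇒≤ v<N)) ⟩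
      ∑ N (earlier j) ∎
      where
      open ≡-Reasoning
      N = suc n
      f : ℕ → ℕ → ℕ
      f u v = indicator (u <? v) * coeff (1 ·q^ δ u v) j
      restrict : ∀ v → v ≤ N → ∑ N (λ u → f u v) ≡ earlier j v
      restrict v v≤N = begin
        ∑ N (λ u → f u v)
          ≡⟨ cong (λ x → ∑ x (λ u → f u v)) (m+[n∸m]≡n v≤N) ⟨
        ∑ (v + (N ∸ v)) (λ u → f u v)
          ≡⟨ ∑-split v (N ∸ v) _ ⟩
        ∑ v (λ u → f u v) + ∑ (N ∸ v) (λ x → f (v + x) v)
          ≡⟨ cong₂ _+_
               (∑-cong v (λ u u<v → trans (cong (_* coeff (1 ·q^ δ u v) j) (indicator-yes (u <? v) u<v)) (*-identityˡ _)))
               (∑-≡0 (N ∸ v) (λ x _ → cong (_* coeff (1 ·q^ δ (v + x) v) j) (indicator-no (v + x <? v) (m+n≮m v x)))) ⟩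
        earlier j v + 0
          ≡⟨ +-identityʳ _ ⟩
        earlier j v ∎

  -- The thresholds n_k and m_k.

  d≡1+[d∸1] : d ≡ 1 + (d ∸ 1)
  d≡1+[d∸1] = sym (m+[n∸m]≡n (>-nonZero⁻¹ d))

  -- threshold 1 k and threshold 2 k are n_k − 1 and m_k − 1, the vertices n_k
  -- and m_k in the numbering from 0. Each arises from its predecessor x as the
  -- first child d x + 2 of x.
  threshold : ℕ → ℕ → ℕ
  threshold a zero    = a
  threshold a (suc k) = 2 + d * threshold a k

  threshold-monoˡ : ∀ k {a b} → a ≤ b → threshold a k ≤ threshold b k
  threshold-monoˡ zero    a≤b = a≤b
  threshold-monoˡ (suc k) a≤b = +-monoʳ-≤ 2 (*-monoʳ-≤ d (threshold-monoˡ k a≤b))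

  -- In an iteration of x ↦ 2 + d x the additional step can also be made first. This permits
  -- comparing iterations of different lengths.
  threshold-suc : ∀ a k → threshold a (suc k) ≡ threshold (2 + d * a) k
  threshold-suc a zero    = refl
  threshold-suc a (suc k) = cong (λ x → 2 + d * x) (threshold-suc a k)

  threshold-monoʳ : ∀ a {i k} → i ≤ k → threshold a i ≤ threshold a k
  threshold-monoʳ a {zero} {k} _ = base k
    where
    base : ∀ k → a ≤ threshold a k
    base zero    = ≤-refl
    base (suc k) = ≤-trans (base k) (≤-trans (m≤n*m (threshold a k) d) (m≤n+m _ 2))
  threshold-monoʳ a (s≤s i≤k) = +-monoʳ-≤ 2 (*-monoʳ-≤ d (threshold-monoʳ a i≤k))

  threshold-2≤1 : ∀ k → threshold 2 k ≤ threshold 1 (suc k)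
  threshold-2≤1 k = ≤-trans (threshold-monoˡ k (m≤m+n 2 (d * 1))) (≤-reflexive (sym (threshold-suc 1 k)))

  -- The quotient (d^k - 1)/(d - 1) in Horner form, free of subtraction and division.
  repunit : ℕ → ℕ
  repunit zero    = 0
  repunit (suc k) = 1 + d * repunit k

  d^k∸1≡repunit : ∀ k → d ^ k ∸ 1 ≡ repunit k * (d ∸ 1)
  d^k∸1≡repunit k = cong (_∸ 1) (pow k)
    where
    -- With `e` for `d ∸ 1`, the identity contains no subtraction.
    expand : ∀ e r → (1 + e) * (1 + r * e) ≡ 1 + (1 + (1 + e) * r) * e
    expand = solve-∀
    pow : ∀ k → d ^ k ≡ 1 + repunit k * (d ∸ 1)
    pow zero    = refl
    pow (suc k) = begin
      d * d ^ k                              ≡⟨ cong₂ _*_ d≡1+[d∸1] (pow k) ⟩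
      (1 + (d ∸ 1)) * (1 + repunit k * (d ∸ 1))  ≡⟨ expand (d ∸ 1) (repunit k) ⟩
      1 + (1 + (1 + (d ∸ 1)) * repunit k) * (d ∸ 1) ≡⟨ cong (λ x → 1 + (1 + x * repunit k) * (d ∸ 1)) d≡1+[d∸1] ⟨
      1 + (1 + d * repunit k) * (d ∸ 1)      ∎
      where open ≡-Reasoning

  [d^k∸1]/[d∸1] : ∀ k .{{_ : NonZero (d ∸ 1)}} → (d ^ k ∸ 1) / (d ∸ 1) ≡ repunit k
  [d^k∸1]/[d∸1] k = trans (cong (_/ (d ∸ 1)) (d^k∸1≡repunit k)) (m*n/n≡m (repunit k) (d ∸ 1))

  private
    d∸1≢0 : NonZero (d ∸ 1)
    d∸1≢0 = >-nonZero (m<n⇒0<n∸m (nonTrivial⇒n>1 d))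

  -- The closed form satisfies the recursion of `threshold`; the outer `suc` is the shift between
  -- numbering from 1 and from 0.
  nₖ-threshold : ∀ k → nₖ d k ≡ suc (threshold 1 k)
  nₖ-threshold k = trans (cong (λ r → 2 + (d + 1) * r) ([d^k∸1]/[d∸1] k {{d∸1≢0}})) (cong suc (sym (closed k)))
    where
    step : ∀ d r → 2 + d * (1 + (d + 1) * r) ≡ 1 + (d + 1) * (1 + d * r)
    step = solve-∀
    closed : ∀ k → threshold 1 k ≡ 1 + (d + 1) * repunit k
    closed zero    = cong suc (sym (*-zeroʳ (d + 1)))
    closed (suc k) = trans (cong (λ x → 2 + d * x) (closed k)) (step d (repunit k))

  mₖ-threshold : ∀ k → mₖ d k ≡ suc (threshold 2 k)
  mₖ-threshold k = trans (cong (λ r → 3 + 2 * d * r) ([d^k∸1]/[d∸1] k {{d∸1≢0}})) (cong suc (sym (closed k)))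
    where
    step : ∀ d r → 2 + d * (2 + 2 * d * r) ≡ 2 + 2 * d * (1 + d * r)
    step = solve-∀
    closed : ∀ k → threshold 2 k ≡ 2 + 2 * d * repunit k
    closed zero    = cong (2 +_) (sym (*-zeroʳ (2 * d)))
    closed (suc k) = trans (cong (λ x → 2 + d * x) (closed k)) (step d (repunit k))

  -- The counts before and after each threshold.

  -- A vertex before the first child of `a` is 0, 1 or a child of a vertex before `a`.
  earlier-below : ∀ j a → (∀ v → v < a → earlier (1 + j) v ≡ 0) →
                  ∀ v → v < 2 + d * a → earlier (3 + j) v ≡ 0
  earlier-below j a zeros 0             v< = refl
  earlier-below j a zeros 1             v< = refl
  earlier-below j a zeros (suc (suc t)) v< = begin
    earlier (3 + j) (2 + t)          ≡⟨ earlier-3+ j t ⟩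
    d * earlier (1 + j) (t / d)      ≡⟨ cong (d *_) (zeros (t / d) (m<n*o⇒m/o<n (subst (t <_) (*-comm d a) (s≤s⁻¹ (s≤s⁻¹ v<))))) ⟩
    d * 0                            ≡⟨ *-zeroʳ d ⟩
    0                                ∎
    where open ≡-Reasoning

  -- The parent of the vertex at offset `x` from the first child of `a` has offset `x / d` from `a`.
  earlier-above : ∀ j a {g : ℕ → ℕ} → (∀ x → earlier (1 + j) (a + x) ≡ g x) →
                  ∀ x → earlier (3 + j) (2 + d * a + x) ≡ d * g (x / d)
  earlier-above j a {g} eq x = begin
    earlier (3 + j) (2 + (d * a + x))        ≡⟨ earlier-3+ j (d * a + x) ⟩
    d * earlier (1 + j) ((d * a + x) / d)    ≡⟨ cong (λ v → d * earlier (1 + j) v) quotient ⟩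
    d * earlier (1 + j) (a + x / d)          ≡⟨ cong (d *_) (eq (x / d)) ⟩
    d * g (x / d)                            ∎
    where
    open ≡-Reasoning
    quotient : (d * a + x) / d ≡ a + x / d
    quotient = trans (+-distrib-/-∣ˡ x (divides a (*-comm d a)))
      (cong (_+ x / d) (trans (cong (_/ d) (*-comm d a)) (m*n/n≡m a d)))

  earlier-odd-below : ∀ i v → v < threshold 1 i → earlier (1 + 2 * i) v ≡ 0
  earlier-odd-below zero    zero _ = refl
  earlier-odd-below zero    (suc v) (s≤s ())
  earlier-odd-below (suc i) v v< rewrite *-suc 2 i = earlier-below (2 * i) (threshold 1 i) (earlier-odd-below i) v v<

  earlier-odd : ∀ i x → earlier (1 + 2 * i) (threshold 1 i + x) ≡ d ^ i
  earlier-odd zero    x = earlier-one x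
  earlier-odd (suc i) x rewrite *-suc 2 i = earlier-above (2 * i) (threshold 1 i) (earlier-odd i) x

  earlier-even-below : ∀ i v → v < threshold 2 i → earlier (2 + 2 * i) v ≡ 0
  earlier-even-below zero    0 _ = refl
  earlier-even-below zero    1 _ = refl
  earlier-even-below zero    (suc (suc v)) (s≤s (s≤s ()))
  earlier-even-below (suc i) v v< rewrite *-suc 2 i = earlier-below (1 + 2 * i) (threshold 2 i) (earlier-even-below i) v v<

  digit : ℕ → ℕ → ℕ
  digit i x = floor/d^ d x i % d

  -- At distance 2 there are `x % d` earlier siblings and one more vertex: the other neighbour of
  -- the parent, be it the grandparent or, under vertex 0, the vertex 1. Passing to parents divides
  -- the offset by `d` and so shifts its digits.
  earlier-even : ∀ i x → earlier (2 + 2 * i) (threshold 2 i + x) ≡ d ^ i * suc (digit i x)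
  earlier-even zero x = begin
    earlier 2 (2 + x)                             ≡⟨ earlier-2+ 0 x ⟩
    d * earlier 0 (x / d) + suc (x % d) * 1       ≡⟨ cong₂ _+_ (trans (cong (d *_) (earlier-zero (x / d))) (*-zeroʳ d)) (*-identityʳ _) ⟩
    suc (x % d)                                   ≡⟨ cong (λ y → suc (y % d)) (n/1≡n x) ⟨
    suc (digit 0 x)                               ≡⟨ *-identityˡ _ ⟨
    1 * suc (digit 0 x)                           ∎
    where open ≡-Reasoning
  earlier-even (suc i) x rewrite *-suc 2 i = begin
    earlier (4 + 2 * i) (threshold 2 (suc i) + x)   ≡⟨ earlier-above (1 + 2 * i) (threshold 2 i) (earlier-even i) x ⟩
    d * (d ^ i * suc (digit i (x / d)))             ≡⟨ *-assoc d (d ^ i) _ ⟨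
    d ^ suc i * suc (digit i (x / d))               ≡⟨ cong (λ y → d ^ suc i * suc (y % d)) (m/n/o≡m/[n*o] x d (d ^ i) {{d≢0}} {{d^≢0 i}} {{d^≢0 (suc i)}}) ⟩
    d ^ suc i * suc (digit (suc i) x)               ∎
    where open ≡-Reasoning

  -- Summation of the counts over all vertices.

  ∑-earlier-odd : ∀ n i → ∑ n (earlier (1 + 2 * i)) ≡ d ^ i * (n ∸ threshold 1 i)
  ∑-earlier-odd n i = begin
    ∑ n (earlier (1 + 2 * i))                 ≡⟨ ∑-shift n (threshold 1 i) (λ _ → d ^ i) (earlier-odd-below i) (earlier-odd i) ⟩
    ∑ (n ∸ threshold 1 i) (λ _ → d ^ i)       ≡⟨ ∑-const (n ∸ threshold 1 i) (d ^ i) ⟩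
    (n ∸ threshold 1 i) * d ^ i               ≡⟨ *-comm _ (d ^ i) ⟩
    d ^ i * (n ∸ threshold 1 i)               ∎
    where open ≡-Reasoning

  ∑-earlier-even : ∀ n i → ∑ n (earlier (2 + 2 * i)) ≡ ∑ (n ∸ threshold 2 i) (λ x → d ^ i * suc (digit i x))
  ∑-earlier-even n i = ∑-shift n (threshold 2 i) _ (earlier-even-below i) (earlier-even i)

  -- The digit is constant on blocks of length `d ^ i`. There are `Q` full cycles of `d` blocks,
  -- then blocks with digits below `l`, then `r + 1` terms with digit `l`; these give the three
  -- summands.
  ∑-digit : ∀ i Q {l r} → l < d → r < d ^ i →
    ∑ (suc (Q * d ^ suc i + (r + l * d ^ i))) (λ x → d ^ i * suc (digit i x)) ≡
      d ^ (2 * i) * Q * ((d + 1) C 2) + d ^ (2 * i) * ((l + 1) C 2) + d ^ i * (l + 1) * (r + 1)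
  ∑-digit i Q {l} {r} l<d r<D = begin
    ∑ (suc (Q * d ^ suc i + (r + l * D))) (λ x → h (_/_ x D {{d^≢0 i}}))
      ≡⟨ cong (λ x → ∑ x (λ x → h (_/_ x D {{d^≢0 i}}))) (count Q d D l r) ⟩
    ∑ ((Q * d + l) * D + suc r) (λ x → h (_/_ x D {{d^≢0 i}}))
      ≡⟨ ∑-/ D {{d^≢0 i}} (Q * d + l) r<D h ⟩
    D * ∑ (Q * d + l) h + suc r * (D * suc ((Q * d + l) % d))
      ≡⟨ cong₂ (λ x y → D * x + suc r * (D * suc y))
           (trans (∑-*ˡ (Q * d + l) D (λ b → suc (b % d))) (cong (D *_) (∑-% d Q (<⇒≤ l<d) suc)))
           ([b*m+x]%m≡x Q d l<d) ⟩
    D * (D * (Q * ∑ d suc + ∑ l suc)) + suc r * (D * suc l)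
      ≡⟨ cong₂ (λ x y → D * (D * (Q * x + y)) + suc r * (D * suc l)) (∑-suc≡C d) (∑-suc≡C l) ⟩
    D * (D * (Q * ((d + 1) C 2) + ((l + 1) C 2))) + suc r * (D * suc l)
      ≡⟨ collect D Q ((d + 1) C 2) ((l + 1) C 2) l r ⟩
    D * D * Q * ((d + 1) C 2) + D * D * ((l + 1) C 2) + D * (l + 1) * (r + 1)
      ≡⟨ cong (λ x → x * Q * ((d + 1) C 2) + x * ((l + 1) C 2) + D * (l + 1) * (r + 1)) square ⟨
    d ^ (2 * i) * Q * ((d + 1) C 2) + d ^ (2 * i) * ((l + 1) C 2) + D * (l + 1) * (r + 1) ∎
    where
    open ≡-Reasoning
    D = d ^ i
    h : ℕ → ℕ
    h b = D * suc (b % d)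
    count : ∀ Q d D l r → suc (Q * (d * D) + (r + l * D)) ≡ (Q * d + l) * D + suc r
    count = solve-∀
    collect : ∀ D Q x y l r →
      D * (D * (Q * x + y)) + suc r * (D * suc l) ≡ D * D * Q * x + D * D * y + D * (l + 1) * (r + 1)
    collect = solve-∀
    square : d ^ (2 * i) ≡ D * D
    square = trans (cong (λ x → d ^ (i + x)) (+-identityʳ i)) (^-distribˡ-+-* d i i)

  -- The label of n and the remainder of n - m_i.

  -- The partial value λ_i of the label, expressed through `∑`.
  value : (ℕ → ℕ) → ℕ → ℕ
  value l i = ∑ i (λ j → l j * d ^ j)

  value-< : ∀ l i → (∀ j → j < i → l j < d) → value l i < d ^ i
  value-< l zero    l<d = ≤-refl
  value-< l (suc i) l<d = begin-strict
    value l i + l i * d ^ i   <⟨ +-monoˡ-< (l i * d ^ i) (value-< l i (λ j j<i → l<d j (m<n⇒m<1+n j<i))) ⟩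
    d ^ i + l i * d ^ i       ≤⟨ *-monoˡ-≤ (d ^ i) (l<d i ≤-refl) ⟩
    d * d ^ i                 ∎
    where open ≤-Reasoning

  value-split : ∀ l i r → ∃ λ q → value l (i + r) ≡ value l i + q * d ^ i
  value-split l i zero rewrite +-identityʳ i = 0 , sym (+-identityʳ _)
  value-split l i (suc r) rewrite +-suc i r with q , eq ← value-split l i r =
    q + l (i + r) * d ^ r , (begin
      value l (i + r) + l (i + r) * d ^ (i + r)
        ≡⟨ cong₂ (λ x y → x + l (i + r) * y) eq (^-distribˡ-+-* d i r) ⟩
      value l i + q * d ^ i + l (i + r) * (d ^ i * d ^ r)
        ≡⟨ collect (value l i) q (d ^ i) (l (i + r)) (d ^ r) ⟩
      value l i + (q + l (i + r) * d ^ r) * d ^ i ∎)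
    where
    open ≡-Reasoning
    collect : ∀ v q D c E → v + q * D + c * (D * E) ≡ v + (q + c * E) * D
    collect = solve-∀

  -- The congruence n_k ≡ m_i + (d - 1) d^k modulo d^(i+1) for k = i + r, where the multiples `X`
  -- and `Y` avoid subtraction. The map x ↦ 2 + d x carries it from i to i + 1.
  threshold-mod : ∀ i r → ∃₂ λ X Y →
    threshold 1 (i + r) + X * d ^ suc i ≡ threshold 2 i + (d ∸ 1) * d ^ (i + r) + Y * d ^ suc i
  -- Both sides are `d + 1`. For positive `r` both thresholds are 2 modulo `d`.
  threshold-mod zero zero = 1 , 0 , trans (cong (λ x → 1 + 1 * (x * 1)) d≡1+[d∸1]) (simplify (d ∸ 1))
    where
    simplify : ∀ e → 1 + 1 * ((1 + e) * 1) ≡ 2 + e * 1 + 0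
    simplify = solve-∀
  threshold-mod zero (suc r) = (d ∸ 1) * d ^ r , threshold 1 r ,
    rearrange d (threshold 1 r) (d ∸ 1) (d ^ r)
    where
    rearrange : ∀ d t e E → 2 + d * t + e * E * (d * 1) ≡ 2 + e * (d * E) + t * (d * 1)
    rearrange = solve-∀
  threshold-mod (suc i) r with X , Y , eq ← threshold-mod i r = X , Y , (begin
    2 + d * a + X * (d * D)                ≡⟨ pull d a X D ⟩
    2 + d * (a + X * D)                    ≡⟨ cong (λ x → 2 + d * x) eq ⟩
    2 + d * (b + (d ∸ 1) * E + Y * D)      ≡⟨ push d b (d ∸ 1) E Y D ⟩
    2 + d * b + (d ∸ 1) * (d * E) + Y * (d * D) ∎)
    where
    open ≡-Reasoning
    a = threshold 1 (i + r)
    b = threshold 2 i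
    D = d ^ suc i
    E = d ^ (i + r)
    pull : ∀ d a X D → 2 + d * a + X * (d * D) ≡ 2 + d * (a + X * D)
    pull = solve-∀
    push : ∀ d b e E Y D → 2 + d * (b + e * E + Y * D) ≡ 2 + d * b + e * (d * E) + Y * (d * D)
    push = solve-∀

  -- By `threshold-mod`, n - m_i is congruent to (n - n_k) + (d - 1) d^k, the number whose digits
  -- form the label; the digits above index `i` vanish modulo d^(i+1).
  label-mod : ∀ {n k i l} → i ≤ k → nₖ d k ≤ n → mₖ d i ≤ n → IsLabel d n k l →
    _%_ (n ∸ mₖ d i) (d ^ suc i) {{d^≢0 (suc i)}} ≡ value l (suc i)
  label-mod {n} {k} {i} {l} i≤k n≥ m≤ (l<d , label)
    with X , Y , eq ← threshold-mod i (k ∸ i)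
    -- The label has `k + 2` digits, and `suc i + suc (k ∸ i)` equals this number.
    with q , split ← value-split l (suc i) (suc (k ∸ i))
    rewrite m+[n∸m]≡n i≤k = begin
      t % D                             ≡⟨ [m+kn]%n≡m%n t X D ⟨
      (t + X * D) % D                   ≡⟨ cong (_% D) congruence ⟨
      (value l (suc i) + (q + Y) * D) % D    ≡⟨ [m+kn]%n≡m%n (value l (suc i)) (q + Y) D ⟩
      value l (suc i) % D               ≡⟨ m<n⇒m%n≡m (value-< l (suc i) (λ j j≤i → l<d j (≤-trans (s≤s⁻¹ j≤i) (≤-trans i≤k (m≤m+n k 1))))) ⟩
      value l (suc i)                   ∎
    where
    open ≡-Reasoning
    D = d ^ suc i
    instance
      D≢0 : NonZero D
      D≢0 = d^≢0 (suc i)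
    t = n ∸ mₖ d i
    a = n ∸ nₖ d k
    T₁ = threshold 1 k
    T₂ = threshold 2 i
    c = (d ∸ 1) * d ^ k

    n-from-a : suc T₁ + a ≡ n
    n-from-a = trans (cong (_+ a) (sym (nₖ-threshold k))) (m+[n∸m]≡n n≥)

    n-from-t : suc T₂ + t ≡ n
    n-from-t = trans (cong (_+ t) (sym (mₖ-threshold i))) (m+[n∸m]≡n m≤)

    total : value l (suc i) + q * D ≡ a + c
    total = begin
      value l (suc i) + q * D             ≡⟨ split ⟨
      value l (suc i + suc (k ∸ i))       ≡⟨ cong (value l) (trans (cong suc (+-suc i (k ∸ i))) (trans (cong (2 +_) (m+[n∸m]≡n i≤k)) (+-comm 2 k))) ⟩
      value l (k + 2)                     ≡⟨ ∑-upTo (k + 2) (λ j → l j * d ^ j) ⟨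
      (Σ[ j < k + 2 ] l j * d ^ j)        ≡⟨ label ⟩
      a + c                               ∎

    congruence : value l (suc i) + (q + Y) * D ≡ t + X * D
    -- Adding `suc T₂ + c` to both sides turns the two differences `t` and `a` back into `n`.
    congruence = +-cancelˡ-≡ (suc T₂ + c) _ _ (begin
      suc T₂ + c + (value l (suc i) + (q + Y) * D)     ≡⟨ e₁ T₂ c (value l (suc i)) q Y D ⟩
      value l (suc i) + q * D + suc (T₂ + c + Y * D)   ≡⟨ cong₂ (λ x y → x + suc y) total (sym eq) ⟩
      a + c + suc (T₁ + X * D)                         ≡⟨ e₂ a c T₁ X D ⟩
      suc T₁ + a + (c + X * D)                         ≡⟨ cong (_+ (c + X * D)) (trans n-from-a (sym n-from-t)) ⟩
      suc T₂ + t + (c + X * D)                         ≡⟨ e₃ T₂ t c X D ⟩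
      suc T₂ + c + (t + X * D)                         ∎)
      where
      e₁ : ∀ T c v q Y D → suc T + c + (v + (q + Y) * D) ≡ v + q * D + suc (T + c + Y * D)
      e₁ = solve-∀
      e₂ : ∀ a c T X D → a + c + suc (T + X * D) ≡ suc T + a + (c + X * D)
      e₂ = solve-∀
      e₃ : ∀ T t c X D → suc T + t + (c + X * D) ≡ suc T + c + (t + X * D)
      e₃ = solve-∀

  -- The threshold is m_i - 1, so there is one term more than n - m_i. Division with remainder
  -- brings the length into the form required by `∑-digit`.
  floor-decomposition : ∀ {n k i l} → i ≤ k → nₖ d k ≤ n → mₖ d i ≤ n → IsLabel d n k l →
    n ∸ threshold 2 i ≡ suc (floor/d^ d (n ∸ mₖ d i) (i + 1) * d ^ suc i + value l (suc i))
  floor-decomposition {n} {k} {i} {l} i≤k n≥ m≤ label = begin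
    n ∸ threshold 2 i                          ≡⟨ +-∸-assoc 1 {o = suc (threshold 2 i)} (≤-trans (≤-reflexive (sym (mₖ-threshold i))) m≤) ⟩
    suc (n ∸ suc (threshold 2 i))              ≡⟨ cong (λ m → suc (n ∸ m)) (mₖ-threshold i) ⟨
    suc t                                      ≡⟨ cong suc (m≡m%n+[m/n]*n t (d ^ suc i)) ⟩
    suc (t % d ^ suc i + t / d ^ suc i * d ^ suc i)
      ≡⟨ cong₂ (λ x e → suc (x + floor/d^ d t e * d ^ suc i)) (label-mod i≤k n≥ m≤ label) (+-comm 1 i) ⟩
    suc (value l (suc i) + floor/d^ d t (i + 1) * d ^ suc i)
      ≡⟨ cong suc (+-comm (value l (suc i)) _) ⟩
    suc (floor/d^ d t (i + 1) * d ^ suc i + value l (suc i)) ∎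
    where
    open ≡-Reasoning
    t = n ∸ mₖ d i
    instance
      D≢0 : NonZero (d ^ suc i)
      D≢0 = d^≢0 (suc i)

  -- Comparison of the coefficients.

  module _ (n k : ℕ) (nₖ≤n : nₖ d k ≤ n) (n<nₖ₊₁ : n < nₖ d (k + 1))
           (l : ℕ → ℕ) (label : IsLabel d n k l)
           (s : ℕ) (s≡ : (n < mₖ d k × s ≡ k) ⊎ (mₖ d k ≤ n × s ≡ k + 1)) where

    oddCoeff evenCoeff : ℕ → ℕ
    oddCoeff i  = d ^ i * (n ∸ nₖ d i + 1)
    evenCoeff i = d ^ (2 * i) * floor/d^ d (n ∸ mₖ d i) (i + 1) * ((d + 1) C 2)
      + d ^ (2 * i) * ((l i + 1) C 2) + d ^ i * (l i + 1) * (λᵢ d l i + 1)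

    n≤threshold₁ : ∀ {i} → k < i → n ≤ threshold 1 i
    n≤threshold₁ {i} k<i = ≤-trans (s≤s⁻¹ (≤-trans n<nₖ₊₁ (≤-reflexive (nₖ-threshold (k + 1)))))
      (threshold-monoʳ 1 (≤-trans (≤-reflexive (+-comm k 1)) k<i))

    threshold₁<n : ∀ {i} → i ≤ k → threshold 1 i < n
    threshold₁<n {i} i≤k = ≤-trans (s≤s (threshold-monoʳ 1 i≤k)) (≤-trans (≤-reflexive (sym (nₖ-threshold k))) nₖ≤n)

    -- The bound `s` is k' + 1. No vertex reaches m_i from there on: either n < m_k, or n < n_(k+1)
    -- ≤ m_(k+1).
    n≤threshold₂ : ∀ {i} → s ≤ i → n ≤ threshold 2 i
    n≤threshold₂ {i} s≤i = [ (λ (n<mₖ , s≡k) → ≤-trans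
        (s≤s⁻¹ (≤-trans n<mₖ (≤-reflexive (mₖ-threshold k))))
        (threshold-monoʳ 2 (subst (_≤ i) s≡k s≤i)))
      , (λ (_ , s≡k+1) → ≤-trans
        (n≤threshold₁ (subst (_≤ i) (trans s≡k+1 (+-comm k 1)) s≤i))
        (threshold-monoˡ i (n≤1+n 1))) ]′ s≡

    i≤k : ∀ {i} → i < s → i ≤ k
    i≤k {i} i<s = [ (λ (_ , s≡k) → <⇒≤ (subst (i <_) s≡k i<s))
      , (λ (_ , s≡k+1) → s≤s⁻¹ (subst (i <_) (trans s≡k+1 (+-comm k 1)) i<s)) ]′ s≡

    -- Either i < k and m_i ≤ n_(i+1) ≤ n_k ≤ n, or i ≤ k and m_i ≤ m_k ≤ n.
    threshold₂<n : ∀ {i} → i < s → threshold 2 i < n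
    threshold₂<n {i} i<s = [ (λ (_ , s≡k) → ≤-<-trans
        (threshold-2≤1 i) (threshold₁<n (subst (i <_) s≡k i<s)))
      , (λ (mₖ≤n , _) → ≤-<-trans
        (threshold-monoʳ 2 (i≤k i<s)) (≤-trans (≤-reflexive (sym (mₖ-threshold k))) mₖ≤n)) ]′ s≡

    coeff-odd : ∀ i → coeff (Σᵖ[ i < k + 1 ] oddTerm d n i) (2 * i + 1) ≡ ∑ n (earlier (2 * i + 1))
    coeff-odd i rewrite +-comm (2 * i) 1 = trans lhs (sym (∑-earlier-odd n i))
      where
      open ≡-Reasoning
      exponent-injective : ∀ {i j} → 2 * i + 1 ≡ 2 * j + 1 → i ≡ j
      exponent-injective {i} {j} eq = *-cancelˡ-≡ i j 2 (+-cancelʳ-≡ 1 (2 * i) (2 * j) eq)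

      lhs : coeff (Σᵖ[ i < k + 1 ] oddTerm d n i) (suc (2 * i)) ≡ d ^ i * (n ∸ threshold 1 i)
      lhs with i ≤? k
      ... | yes i≤k = begin
        coeff (Σᵖ[ i < k + 1 ] oddTerm d n i) (suc (2 * i))
          ≡⟨ cong (coeff (Σᵖ[ i < k + 1 ] oddTerm d n i)) (+-comm 1 (2 * i)) ⟩
        coeff (Σᵖ[ i < k + 1 ] oddTerm d n i) (2 * i + 1)
          ≡⟨ coeff-Σᵖ-< oddCoeff (λ i → 2 * i + 1) exponent-injective (≤-trans (s≤s i≤k) (≤-reflexive (+-comm 1 k))) ⟩
        d ^ i * (n ∸ nₖ d i + 1)
          ≡⟨ cong (λ m → d ^ i * (n ∸ m + 1)) (nₖ-threshold i) ⟩
        d ^ i * (n ∸ suc (threshold 1 i) + 1)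
          -- Since n_i ≤ n, the 1 can be absorbed into the truncated subtraction.
          ≡⟨ cong (d ^ i *_) (trans (+-comm _ 1) (sym (+-∸-assoc 1 {o = suc (threshold 1 i)} (threshold₁<n i≤k)))) ⟩
        d ^ i * (n ∸ threshold 1 i) ∎
      ... | no i≰k = trans
        (coeff-Σᵖ-≡0 oddCoeff (λ i → 2 * i + 1) (k + 1) (suc (2 * i)) λ h h<k+1 eq →
          i≰k (subst (_≤ k) (exponent-injective {h} {i} (trans eq (+-comm 1 (2 * i)))) (s≤s⁻¹ (≤-trans h<k+1 (≤-reflexive (+-comm k 1))))))
        (sym (trans (cong (d ^ i *_) (m≤n⇒m∸n≡0 (n≤threshold₁ (≰⇒> i≰k)))) (*-zeroʳ (d ^ i))))

    coeff-even : ∀ i → coeff (Σᵖ[ i < s ] evenTerm d n l i) (2 * i + 2) ≡ ∑ n (earlier (2 * i + 2))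
    coeff-even i = trans lhs (sym (trans (cong (λ j → ∑ n (earlier j)) (+-comm (2 * i) 2)) (∑-earlier-even n i)))
      where
      open ≡-Reasoning
      exponent-injective : ∀ {i j} → 2 * i + 2 ≡ 2 * j + 2 → i ≡ j
      exponent-injective {i} {j} eq = *-cancelˡ-≡ i j 2 (+-cancelʳ-≡ 2 (2 * i) (2 * j) eq)

      lhs : coeff (Σᵖ[ i < s ] evenTerm d n l i) (2 * i + 2) ≡
            ∑ (n ∸ threshold 2 i) (λ x → d ^ i * suc (digit i x))
      lhs with i <? s
      ... | yes i<s = begin
        coeff (Σᵖ[ i < s ] evenTerm d n l i) (2 * i + 2)
          ≡⟨ coeff-Σᵖ-< evenCoeff (λ i → 2 * i + 2) exponent-injective i<s ⟩
        evenCoeff i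
          ≡⟨ cong (λ v → d ^ (2 * i) * Q * ((d + 1) C 2) + d ^ (2 * i) * ((l i + 1) C 2) + d ^ i * (l i + 1) * (v + 1))
               (∑-upTo i (λ j → l j * d ^ j)) ⟩
        d ^ (2 * i) * Q * ((d + 1) C 2) + d ^ (2 * i) * ((l i + 1) C 2) + d ^ i * (l i + 1) * (value l i + 1)
          -- Here r is `value l i`, and `value l (suc i)` unfolds to `value l i + l i * d ^ i`.
          ≡⟨ ∑-digit i Q (l<d i ≤-refl) (value-< l i (λ j j<i → l<d j (<⇒≤ j<i))) ⟨
        ∑ (suc (Q * d ^ suc i + value l (suc i))) (λ x → d ^ i * suc (digit i x))
          ≡⟨ cong (λ m → ∑ m (λ x → d ^ i * suc (digit i x)))
               (floor-decomposition (i≤k i<s) nₖ≤n (≤-trans (≤-reflexive (mₖ-threshold i)) (threshold₂<n i<s)) label) ⟨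
        ∑ (n ∸ threshold 2 i) (λ x → d ^ i * suc (digit i x)) ∎
        where
        Q = floor/d^ d (n ∸ mₖ d i) (i + 1)
        l<d : ∀ j → j ≤ i → l j < d
        l<d j j≤i = proj₁ label j (≤-trans j≤i (≤-trans (i≤k i<s) (m≤m+n k 1)))
      ... | no i≮s = trans
        (coeff-Σᵖ-≡0 evenCoeff (λ i → 2 * i + 2) s (2 * i + 2) λ h h<s eq →
          i≮s (subst (_< s) (exponent-injective {h} {i} eq) h<s))
        (cong (λ m → ∑ m (λ x → d ^ i * suc (digit i x))) (sym (m≤n⇒m∸n≡0 (n≤threshold₂ (≮⇒≥ i≮s)))))

    -- The exponents of the two sums differ in parity, so at most one sum contributes. At exponent 0
    -- both sides vanish, as distinct vertices have positive distance.
    coeff-rhs : ∀ j → coeff ((Σᵖ[ i < k + 1 ] oddTerm d n i) ⊕ (Σᵖ[ i < s ] evenTerm d n l i)) j ≡ ∑ n (earlier j)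
    coeff-rhs j = trans (coeff-⊕ (Σᵖ[ i < k + 1 ] oddTerm d n i) (Σᵖ[ i < s ] evenTerm d n l i) j)
                        (cases (zero-odd-even j))
      where
      oddPart-≡0 : ∀ j → (∀ i → 2 * i + 1 ≢ j) → coeff (Σᵖ[ i < k + 1 ] oddTerm d n i) j ≡ 0
      oddPart-≡0 j ≢j = coeff-Σᵖ-≡0 oddCoeff (λ i → 2 * i + 1) (k + 1) j (λ i _ → ≢j i)

      evenPart-≡0 : ∀ j → (∀ i → 2 * i + 2 ≢ j) → coeff (Σᵖ[ i < s ] evenTerm d n l i) j ≡ 0
      evenPart-≡0 j ≢j = coeff-Σᵖ-≡0 evenCoeff (λ i → 2 * i + 2) s j (λ i _ → ≢j i)

      cases : (j ≡ 0) ⊎ (∃ λ i → j ≡ 2 * i + 1) ⊎ (∃ λ i → j ≡ 2 * i + 2) →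
        coeff (Σᵖ[ i < k + 1 ] oddTerm d n i) j + coeff (Σᵖ[ i < s ] evenTerm d n l i) j ≡ ∑ n (earlier j)
      cases (inj₁ refl) = trans
        (cong₂ _+_ (oddPart-≡0 0 (λ i → m+1+n≢0 (2 * i))) (evenPart-≡0 0 (λ i → m+1+n≢0 (2 * i))))
        (sym (∑-≡0 n (λ v _ → earlier-zero v)))
      cases (inj₂ (inj₁ (i , refl))) = trans
        (cong₂ _+_ (coeff-odd i) (evenPart-≡0 (2 * i + 1) (λ h eq → 2i+1≢2j+2 i h (sym eq))))
        (+-identityʳ _)
      cases (inj₂ (inj₂ (i , refl))) =
        cong₂ _+_ (oddPart-≡0 (2 * i + 2) (λ h → 2i+1≢2j+2 h i)) (coeff-even i)

theorem2p2 : (d : ℕ) .{{_ : NonTrivial d}} (n : ℕ) .{{_ : NonTrivial n}}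
    (k : ℕ) → nₖ d k ≤ n → n < nₖ d (k + 1) →
    (l : ℕ → ℕ) → IsLabel d n k l →
    (s : ℕ) → (n < mₖ d k × s ≡ k) ⊎ (mₖ d k ≤ n × s ≡ k + 1) →
    W (dendrimer d n {{nonTrivial⇒nonZero n}}) (dendrimer-connected d n {{nonTrivial⇒nonZero n}})
    ≈ (Σᵖ[ i < k + 1 ] oddTerm d n i) ⊕ (Σᵖ[ i < s ] evenTerm d n l i)
theorem2p2 d n@(suc m) k n≥ n< l label s s≡ j =
  trans (coeff-W m (dendrimer-connected d n) j) (sym (coeff-rhs n k n≥ n< l label s s≡ j))
  where
  open Dendrimer d
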